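{- Let $q$ be a power of an odd prime with $q\equiv 3\pmod 4$, and let $d\equiv 1\pmod 4$ be a positive integer. Let $P\subset\mathbb{F}_q^d$ be a set of points and $S$ a set of spheres in $\mathbb{F}_q^d$ all of whose radii are non-squares in $\mathbb{F}_q$. If $|P|\le N$ and $|S|\le N$, then \[ I(P,S)\ll q^{ -1}N^2+q^{\frac{d-1}{2}}N. \]
   Context: A sphere in $\mathbb{F}_q^d$ with center $c\in\mathbb{F}_q^d$ and radius $r\in\mathbb{F}_q$ is $\{x : \sum_{i=1}^d (x_i-c_i)^2=r\}$; spheres are indexed by (center, radius). A radius $r$ is a non-square if $r\neq 0$ and $r\ne t^2$ for all $t\in\mathbb{F}_q$. $I(P,S)=\#\{(p,s)\in P\times S : p\in s\}$. $X\ll Y$ means $X\le CY$ for an absolute constant $C>0$. -}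

module Defs where

open import Algebra.Bundles using (CommutativeRing)
import Algebra.Definitions as AlgebraDefinitions
import Algebra.Properties.CommutativeMonoid.Sum as Sum
open import Data.Fin.Base using (Fin)
import Data.Fin.Properties as Fin
open import Data.List.Base using (List; cartesianProduct; filter; length)
open import Data.Nat.Base using (ℕ; NonZero; _^_)
open import Data.Nat.Divisibility using (_∤_)
open import Data.Nat.Primality using (Prime)
open import Data.Product.Base using (∃₂; _×_; _,_; uncurry)
open import Data.Product.Relation.Binary.Pointwise.NonDependent using (_×ₛ_)
import Data.Vec.Functional.Relation.Binary.Equality.Setoid as VectorEquality
open import Function.Bundles using (Bijection)
open import Level using (Level; _⊔_; suc)
open import Relation.Binary.Bundles using (Setoid)
open import Relation.Binary.Definitions using (Decidable)
open import Relation.Binary.PropositionalEquality using (_≡_; setoid)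
open import Relation.Nullary.Decidable using (map′)

IsOddPrimePower : ℕ → Set
IsOddPrimePower q = ∃₂ λ p k → Prime p × 2 ∤ p × NonZero k × q ≡ p ^ k

-- A field with exactly q elements (up to _≈_).
record FiniteField (c ℓ : Level) (q : ℕ) : Set (suc (c ⊔ ℓ)) where
  field
    commutativeRing : CommutativeRing c ℓ

  open CommutativeRing commutativeRing public renaming (setoid to ≈-setoid)
  open AlgebraDefinitions _≈_ using (Invertible)

  field
    1≉0           : 1# ≉ 0#
    ≉0⇒invertible : ∀ {x} → x ≉ 0# → Invertible 1# _*_ x
    enumeration   : Bijection ≈-setoid (setoid (Fin q))

  _≟_ : Decidable _≈_
  x ≟ y = map′ injective cong (to x Fin.≟ to y)
    where open Bijection enumeration

module Spheres {c ℓ : Level} {q : ℕ} (F : FiniteField c ℓ q) (d : ℕ) where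
  open FiniteField F
  open Sum +-commutativeMonoid using (sum)

  NonSquare : Carrier → Set (c ⊔ ℓ)
  NonSquare r = r ≉ 0# × (∀ t → r ≉ t * t)

  points : Setoid c ℓ
  points = VectorEquality.≋-setoid ≈-setoid d

  -- A sphere is the pair (centre , radius); spheres are distinguished by these
  -- data rather than by their sets of points.
  spheres : Setoid c ℓ
  spheres = points ×ₛ ≈-setoid

  Point : Set c
  Point = Setoid.Carrier points

  Sphere : Set c
  Sphere = Setoid.Carrier spheres

  _liesOn_ : Point → Sphere → Set ℓ
  x liesOn (a , r) = sum (λ i → (x i - a i) * (x i - a i)) ≈ r

  _liesOn?_ : Decidable _liesOn_
  x liesOn? (a , r) = sum (λ i → (x i - a i) * (x i - a i)) ≟ r

  -- This counts incident pairs when both lists are duplicate-free.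
  incidences : List Point → List Sphere → ℕ
  incidences P S = length (filter (uncurry _liesOn?_) (cartesianProduct P S))

{-# OPTIONS --safe #-}

-- Since q ≡ 3 (mod 4), a nonsquare r is −t², so a point x lies on the sphere
-- (a , r) iff (0 , x) and (t , a) are at distance zero for the sum of n = d + 1
-- squares.  Here n = 2h with h odd, and this form is elliptic: the matrix
-- T = (q[dist x y = 0] − 1) satisfies T² = (q − 1)qⁿ I − qʰ(q − 2) T, that is
-- (T − qʰ)(T + (q − 1)qʰ) = 0, so T ≤ qʰ I.  Applying this to the indicator
-- vector of the lifted points and spheres, L in number, bounds q times the
-- number of pairs at distance zero by L² + qʰ L.
--
-- Instead of Gauss sums, T² is computed by counting the common zeros z of
-- A = dist z x and B = dist z y through the pencil A + cB: completing the square
-- turns each member into a sphere, except for c = −1, where it is a hyperplane.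
module Submission where

open import Defs
open import Algebra.Bundles using (CommutativeRing; RawRing)
open import Algebra.Morphism.Structures using (IsRingMonomorphism)
import Algebra.Morphism.RingMonomorphism as RingMonomorphism
import Algebra.Properties.CommutativeMonoid.Sum as Sum
import Algebra.Properties.Ring as RingProperties
import Algebra.Properties.Semiring.Mult.TCOptimised as Mult
import Algebra.Solver.Ring as RingSolver
open import Algebra.Solver.Ring.AlmostCommutativeRing using (fromCommutativeRing; _-Raw-AlmostCommutative⟶_)
open import Algebra.Structures using (IsCommutativeRing)
open import Data.Empty using (⊥; ⊥-elim)
open import Data.Fin.Base as Fin using (Fin)
import Data.Fin.Properties as Fin
open import Data.Integer.Base as ℤ using (ℤ; 0ℤ; 1ℤ)
import Data.Integer.Properties as ℤ
open import Data.Integer.Tactic.RingSolver using (solve-∀)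
open import Data.List.Base using (List; []; _∷_; _++_; allFin; cartesianProduct; concatMap; filter; length; map; tabulate)
open import Data.List.Membership.Propositional using (_∈_)
open import Data.List.Membership.Propositional.Properties using (∈-allFin)
import Data.List.Properties as List
open import Data.List.Relation.Unary.All as All using (All; []; _∷_)
import Data.List.Relation.Unary.All.Properties as All
open import Data.List.Relation.Unary.AllPairs as AllPairs using (AllPairs; []; _∷_)
import Data.List.Relation.Unary.AllPairs.Properties as AllPairs
open import Data.List.Relation.Unary.Any using (here; there)
import Data.List.Relation.Unary.Unique.Propositional as Propositional
open import Data.List.Relation.Unary.Unique.Setoid using (Unique)
open import Data.Maybe.Base using (Maybe; just; nothing)
open import Data.Nat.Base as ℕ using (ℕ; NonZero; zero; suc; _^_; _∸_)
open import Data.Nat.DivMod as ℕ using (_%_)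
import Data.Nat.Properties as ℕ
import Data.Nat.Tactic.RingSolver as ℕ
open import Data.Product.Base using (∃-syntax; _×_; _,_; proj₁; proj₂; uncurry)
import Data.Rational.Base as ℚ
import Data.Rational.Properties as ℚ
import Data.Rational.Unnormalised.Base as ℚᵘ
import Data.Rational.Unnormalised.Properties as ℚᵘ
open import Data.Vec.Base as Vec using (Vec; []; _∷_)
import Data.Vec.Properties as Vec
open import Function.Base using (_∘_; case_of_)
open import Function.Bundles using (Bijection)
open import Level using (Level)
open import Relation.Binary.Definitions using (DecidableEquality; tri<; tri≈; tri>)
open import Relation.Binary.PropositionalEquality as ≡ using (_≡_; _≢_; refl; sym; trans; cong; cong₂; subst; subst₂; module ≡-Reasoning)
import Relation.Binary.Reasoning.Setoid as SetoidReasoning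
open import Relation.Nullary.Decidable using (Dec; yes; no)
open import Relation.Nullary.Negation using (¬_)

-- The two eigenvalues of T differ in size by a factor q - 1. A bilinear estimate between points and
-- spheres through the operator norm would pay for the larger one, -(q - 1)qʰ, and lose a factor of
-- about q. A quadratic form only meets the upper eigenvalue qʰ from above; so points and spheres
-- enter one indicator vector, and the point-point and sphere-sphere pairs at distance zero, counted
-- with a positive sign, are simply discarded. The sign of the form is what the congruences secure.
-- As -1 is a nonsquare, adding two squares multiplies the centred indicator of zero by -q, and d ≡
-- 1 (mod 4) makes h = (d + 1)/2 odd, whence (-q)ʰ = -qʰ. The lifts have to be pairwise distinct,
-- since the diagonal must contribute no more than qʰL; a sphere is kept apart from the lifted
-- points by t ≠ 0. Dividing by q leaves q^(h - 1) = q^((d - 1)/2), and L ≤ 2N accounts for the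
-- constant 4.

-- Ring normalisation with integer coefficients.

module IntegerCoefficients {c ℓ} (R : CommutativeRing c ℓ) where
  open import Data.Integer.Base using (+_; -[1+_]; _⊖_)
  open CommutativeRing R renaming (refl to ≈-refl; sym to ≈-sym; trans to ≈-trans)
  open RingProperties ring
  open Mult semiring renaming (_×_ to _·_)
  open SetoidReasoning setoid

  -- The canonical homomorphism from ℤ. With integer coefficients the solver cancels terms by
  -- deciding equality in ℤ, so no decision procedure on `Carrier` is involved.
  ⟦_⟧ℤ : ℤ → Carrier
  ⟦ + n ⟧ℤ      = n · 1#
  ⟦ -[1+ n ] ⟧ℤ = - (suc n · 1#)

  private
    ⟦-_⟧ : ∀ i → ⟦ ℤ.- i ⟧ℤ ≈ - ⟦ i ⟧ℤ
    ⟦- + zero ⟧     = ≈-sym -0#≈0#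
    ⟦- + suc n ⟧    = ≈-refl
    ⟦- -[1+ n ] ⟧   = ≈-sym (-‿involutive _)

    cancel-1 : ∀ a b → (1# + a) + - (1# + b) ≈ a + - b
    cancel-1 a b = begin
      (1# + a) + - (1# + b)     ≈⟨ +-cong (+-comm 1# a) (≈-sym (-‿+-comm 1# b)) ⟩
      (a + 1#) + (- 1# + - b)   ≈⟨ +-assoc a 1# _ ⟩
      a + (1# + (- 1# + - b))   ≈⟨ +-congˡ (+-assoc 1# (- 1#) (- b)) ⟨
      a + ((1# + - 1#) + - b)   ≈⟨ +-congˡ (+-congʳ (-‿inverseʳ 1#)) ⟩
      a + (0# + - b)            ≈⟨ +-congˡ (+-identityˡ _) ⟩
      a + - b                   ∎

    ⟦⊖⟧ : ∀ m n → ⟦ m ⊖ n ⟧ℤ ≈ m · 1# + - (n · 1#)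
    ⟦⊖⟧ m zero = ≈-sym (≈-trans (+-congˡ -0#≈0#) (+-identityʳ _))
    ⟦⊖⟧ zero (suc n) = ≈-sym (+-identityˡ _)
    ⟦⊖⟧ (suc m) (suc n) = begin
      ⟦ suc m ⊖ suc n ⟧ℤ                 ≡⟨ ≡.cong ⟦_⟧ℤ (ℤ.[1+m]⊖[1+n]≡m⊖n m n) ⟩
      ⟦ m ⊖ n ⟧ℤ                         ≈⟨ ⟦⊖⟧ m n ⟩
      m · 1# + - (n · 1#)                ≈⟨ cancel-1 _ _ ⟨
      (1# + m · 1#) + - (1# + n · 1#)    ≈⟨ +-cong (1+× m 1#) (-‿cong (1+× n 1#)) ⟨
      suc m · 1# + - (suc n · 1#)        ∎

    +-homo : ∀ i j → ⟦ i ℤ.+ j ⟧ℤ ≈ ⟦ i ⟧ℤ + ⟦ j ⟧ℤ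
    +-homo (+ m) (+ n) = ×-homo-+ 1# m n
    +-homo (+ m) -[1+ n ] = ⟦⊖⟧ m (suc n)
    +-homo -[1+ m ] (+ n) = ≈-trans (⟦⊖⟧ n (suc m)) (+-comm _ _)
    +-homo -[1+ m ] -[1+ n ] = begin
      - (suc (suc (m ℕ.+ n)) · 1#)     ≡⟨ ≡.cong (λ k → - (k · 1#)) (≡.sym (ℕ.+-suc (suc m) n)) ⟩
      - ((suc m ℕ.+ suc n) · 1#)       ≈⟨ -‿cong (×-homo-+ 1# (suc m) (suc n)) ⟩
      - (suc m · 1# + suc n · 1#)      ≈⟨ -‿+-comm _ _ ⟨
      - (suc m · 1#) + - (suc n · 1#)  ∎

    *-homo-+ : ∀ i n → ⟦ i ℤ.* + n ⟧ℤ ≈ ⟦ i ⟧ℤ * ⟦ + n ⟧ℤ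
    *-homo-+ (+ m) n = begin
      ⟦ + m ℤ.* + n ⟧ℤ       ≡⟨ ≡.cong ⟦_⟧ℤ (ℤ.pos-* m n) ⟨
      (m ℕ.* n) · 1#         ≈⟨ ×1-homo-* m n ⟩
      (m · 1#) * (n · 1#)    ∎
    *-homo-+ -[1+ m ] n = begin
      ⟦ ℤ.- (+ suc m) ℤ.* + n ⟧ℤ    ≡⟨ ≡.cong ⟦_⟧ℤ (ℤ.neg-distribˡ-* (+ suc m) (+ n)) ⟨
      ⟦ ℤ.- (+ suc m ℤ.* + n) ⟧ℤ    ≈⟨ ⟦- (+ suc m ℤ.* + n) ⟧ ⟩
      - ⟦ + suc m ℤ.* + n ⟧ℤ        ≈⟨ -‿cong (*-homo-+ (+ suc m) n) ⟩
      - ((suc m · 1#) * (n · 1#))   ≈⟨ -‿distribˡ-* _ _ ⟩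
      - (suc m · 1#) * (n · 1#)     ∎

    *-homo : ∀ i j → ⟦ i ℤ.* j ⟧ℤ ≈ ⟦ i ⟧ℤ * ⟦ j ⟧ℤ
    *-homo i (+ n) = *-homo-+ i n
    *-homo i -[1+ n ] = begin
      ⟦ i ℤ.* (ℤ.- (+ suc n)) ⟧ℤ    ≡⟨ ≡.cong ⟦_⟧ℤ (ℤ.neg-distribʳ-* i (+ suc n)) ⟨
      ⟦ ℤ.- (i ℤ.* + suc n) ⟧ℤ      ≈⟨ ⟦- (i ℤ.* + suc n) ⟧ ⟩
      - ⟦ i ℤ.* + suc n ⟧ℤ          ≈⟨ -‿cong (*-homo-+ i (suc n)) ⟩
      - (⟦ i ⟧ℤ * (suc n · 1#))     ≈⟨ -‿distribʳ-* _ _ ⟩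
      ⟦ i ⟧ℤ * - (suc n · 1#)       ∎

    morphism : CommutativeRing.rawRing ℤ.+-*-commutativeRing -Raw-AlmostCommutative⟶ fromCommutativeRing R
    morphism = record
      { ⟦_⟧    = ⟦_⟧ℤ
      ; +-homo = +-homo
      ; *-homo = *-homo
      ; -‿homo = ⟦-_⟧
      ; 0-homo = ≈-refl
      ; 1-homo = ≈-refl
      }

    coefficient≟ : ∀ i j → Maybe (⟦ i ⟧ℤ ≈ ⟦ j ⟧ℤ)
    coefficient≟ i j with i ℤ.≟ j
    ... | yes ≡.refl = just ≈-refl
    ... | no _       = nothing

  open RingSolver (CommutativeRing.rawRing ℤ.+-*-commutativeRing) (fromCommutativeRing R) morphism coefficient≟ public
    using (solve; _:=_; _:+_; _:*_; _:-_; :-_; con)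

-- Integer-valued sums over lists, indicators and enumerations.

module FiniteSums where
  open import Data.Integer.Base using (_+_; _*_; _-_; -_; _≤_; +≤+)

  private variable
    a b p r : Level
    A : Set a
    B : Set b
    P : Set p
    R : Set r

  [_] : Dec P → ℤ
  [ yes _ ] = 1ℤ
  [ no _ ]  = 0ℤ

  []-true : (P? : Dec P) → P → [ P? ] ≡ 1ℤ
  []-true (yes _) _ = refl
  []-true (no ¬p) p = ⊥-elim (¬p p)

  []-false : (P? : Dec P) → ¬ P → [ P? ] ≡ 0ℤ
  []-false (yes p) ¬p = ⊥-elim (¬p p)
  []-false (no _) _   = refl

  []-mono : (P? : Dec P) (R? : Dec R) → (P → R) → [ P? ] ≤ [ R? ]
  []-mono (yes p) R? f = ℤ.≤-reflexive (sym ([]-true R? (f p)))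
  []-mono (no _) (yes _) f = +≤+ ℕ.z≤n
  []-mono (no _) (no _) f = ℤ.≤-refl

  []-cong : (P? : Dec P) (R? : Dec R) → (P → R) → (R → P) → [ P? ] ≡ [ R? ]
  []-cong P? R? f g = ℤ.≤-antisym ([]-mono P? R? f) ([]-mono R? P? g)

  0≤[_] : (P? : Dec P) → 0ℤ ≤ [ P? ]
  0≤[ yes _ ] = +≤+ ℕ.z≤n
  0≤[ no _ ]  = ℤ.≤-refl

  pos-^ : ∀ m n → ℤ.+ (m ℕ.^ n) ≡ (ℤ.+ m) ℤ.^ n
  pos-^ m zero    = refl
  pos-^ m (suc n) = trans (ℤ.pos-* m (m ℕ.^ n)) (cong (ℤ.+ m *_) (pos-^ m n))

  0≤i*i : ∀ i → 0ℤ ≤ i * i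
  0≤i*i (ℤ.+ n)    = subst (0ℤ ≤_) (ℤ.pos-* n n) (+≤+ ℕ.z≤n)
  0≤i*i ℤ.-[1+ n ] = +≤+ ℕ.z≤n

  -- The parity obstruction behind both `𝟙⊕𝟙≢𝟘` and `⊖𝟙-nonsquare`.
  i+i≢1 : ∀ i → i + i ≢ 1ℤ
  i+i≢1 (ℤ.+ suc (suc n)) eq with trans (sym (cong ℤ.∣_∣ eq)) refl
  ... | ()
  i+i≢1 (ℤ.+ 0) ()
  i+i≢1 (ℤ.+ 1) ()
  i+i≢1 ℤ.-[1+ n ] ()

  ∑ : List A → (A → ℤ) → ℤ
  ∑ []       f = 0ℤ
  ∑ (x ∷ xs) f = f x + ∑ xs f

  ∑-cong : ∀ (xs : List A) {f g} → (∀ x → f x ≡ g x) → ∑ xs f ≡ ∑ xs g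
  ∑-cong []       eq = refl
  ∑-cong (x ∷ xs) eq = cong₂ _+_ (eq x) (∑-cong xs eq)

  ∑-mono : ∀ (xs : List A) {f g} → (∀ x → f x ≤ g x) → ∑ xs f ≤ ∑ xs g
  ∑-mono []       le = ℤ.≤-refl
  ∑-mono (x ∷ xs) le = ℤ.+-mono-≤ (le x) (∑-mono xs le)

  ∑-zero : ∀ (xs : List A) → ∑ xs (λ _ → 0ℤ) ≡ 0ℤ
  ∑-zero []       = refl
  ∑-zero (x ∷ xs) = trans (ℤ.+-identityˡ _) (∑-zero xs)

  0≤∑ : ∀ (xs : List A) {f} → (∀ x → 0ℤ ≤ f x) → 0ℤ ≤ ∑ xs f
  0≤∑ xs {f} le = subst (_≤ ∑ xs f) (∑-zero xs) (∑-mono xs le)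

  ∑-+ : ∀ (xs : List A) {f g} → ∑ xs (λ x → f x + g x) ≡ ∑ xs f + ∑ xs g
  ∑-+ []       = refl
  ∑-+ (x ∷ xs) {f} {g} = trans (cong ((f x + g x) +_) (∑-+ xs)) (interchange (f x) (g x) _ _)
    where
    interchange : ∀ i j k l → (i + j) + (k + l) ≡ (i + k) + (j + l)
    interchange = solve-∀

  ∑-*ˡ : ∀ (xs : List A) k {f} → ∑ xs (λ x → k * f x) ≡ k * ∑ xs f
  ∑-*ˡ []       k = sym (ℤ.*-zeroʳ k)
  ∑-*ˡ (x ∷ xs) k {f} = trans (cong (k * f x +_) (∑-*ˡ xs k)) (sym (ℤ.*-distribˡ-+ k (f x) _))

  ∑-*ʳ : ∀ (xs : List A) k {f} → ∑ xs (λ x → f x * k) ≡ ∑ xs f * k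
  ∑-*ʳ xs k {f} = begin
    ∑ xs (λ x → f x * k) ≡⟨ ∑-cong xs (λ x → ℤ.*-comm (f x) k) ⟩
    ∑ xs (λ x → k * f x) ≡⟨ ∑-*ˡ xs k ⟩
    k * ∑ xs f           ≡⟨ ℤ.*-comm k _ ⟩
    ∑ xs f * k           ∎
    where open ≡-Reasoning

  ∑-neg : ∀ (xs : List A) {f} → ∑ xs (λ x → - f x) ≡ - ∑ xs f
  ∑-neg []           = refl
  ∑-neg (x ∷ xs) {f} = trans (cong (- f x +_) (∑-neg xs)) (sym (ℤ.neg-distrib-+ (f x) _))

  ∑-- : ∀ (xs : List A) {f g} → ∑ xs (λ x → f x - g x) ≡ ∑ xs f - ∑ xs g
  ∑-- xs {f} = trans (∑-+ xs) (cong (∑ xs f +_) (∑-neg xs))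

  ∑-swap : ∀ (xs : List A) (ys : List B) {f : A → B → ℤ} →
           ∑ xs (λ x → ∑ ys (f x)) ≡ ∑ ys (λ y → ∑ xs (λ x → f x y))
  ∑-swap []       ys = sym (∑-zero ys)
  ∑-swap (x ∷ xs) ys {f} = trans (cong (∑ ys (f x) +_) (∑-swap xs ys)) (sym (∑-+ ys))

  ∑-++ : ∀ (xs ys : List A) {f} → ∑ (xs ++ ys) f ≡ ∑ xs f + ∑ ys f
  ∑-++ []       ys     = sym (ℤ.+-identityˡ _)
  ∑-++ (x ∷ xs) ys {f} = trans (cong (f x +_) (∑-++ xs ys)) (sym (ℤ.+-assoc (f x) _ _))

  ∑-mono-++ˡ : ∀ (xs ys : List A) {f} → (∀ x → 0ℤ ≤ f x) → ∑ xs f ≤ ∑ (xs ++ ys) f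
  ∑-mono-++ˡ xs ys {f} 0≤f = subst₂ _≤_ (ℤ.+-identityʳ _) (sym (∑-++ xs ys)) (ℤ.+-monoʳ-≤ (∑ xs f) (0≤∑ ys 0≤f))

  ∑-mono-++ʳ : ∀ (xs ys : List A) {f} → (∀ x → 0ℤ ≤ f x) → ∑ ys f ≤ ∑ (xs ++ ys) f
  ∑-mono-++ʳ xs ys {f} 0≤f = subst₂ _≤_ (ℤ.+-identityˡ _) (sym (∑-++ xs ys)) (ℤ.+-monoˡ-≤ (∑ ys f) (0≤∑ xs 0≤f))

  ∑-map : ∀ (g : A → B) xs {f} → ∑ (map g xs) f ≡ ∑ xs (f ∘ g)
  ∑-map g []           = refl
  ∑-map g (x ∷ xs) {f} = cong (f (g x) +_) (∑-map g xs)

  ∑-concatMap : ∀ (g : A → List B) xs {f} → ∑ (concatMap g xs) f ≡ ∑ xs (λ x → ∑ (g x) f)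
  ∑-concatMap g []           = refl
  ∑-concatMap g (x ∷ xs) {f} = trans (∑-++ (g x) _) (cong (∑ (g x) f +_) (∑-concatMap g xs))

  ∑-1 : ∀ (xs : List A) → ∑ xs (λ _ → 1ℤ) ≡ ℤ.+ length xs
  ∑-1 []       = refl
  ∑-1 (x ∷ xs) = cong (1ℤ +_) (∑-1 xs)

  ∑-const : ∀ (xs : List A) k → ∑ xs (λ _ → k) ≡ ℤ.+ length xs * k
  ∑-const xs k = begin
    ∑ xs (λ _ → k)        ≡⟨ ∑-cong xs (λ _ → sym (ℤ.*-identityˡ k)) ⟩
    ∑ xs (λ _ → 1ℤ * k)   ≡⟨ ∑-*ʳ xs k ⟩
    ∑ xs (λ _ → 1ℤ) * k   ≡⟨ cong (_* k) (∑-1 xs) ⟩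
    ℤ.+ length xs * k       ∎
    where open ≡-Reasoning

  ∑-∈ : ∀ {xs : List A} {f y} → (∀ x → 0ℤ ≤ f x) → y ∈ xs → f y ≤ ∑ xs f
  ∑-∈ {xs = x ∷ xs} {f} 0≤f (here refl) =
    subst (_≤ f x + ∑ xs f) (ℤ.+-identityʳ (f x)) (ℤ.+-monoʳ-≤ (f x) (0≤∑ xs 0≤f))
  ∑-∈ {xs = x ∷ xs} {f} {y} 0≤f (there y∈xs) =
    subst (_≤ f x + ∑ xs f) (ℤ.+-identityˡ (f y)) (ℤ.+-mono-≤ (0≤f x) (∑-∈ 0≤f y∈xs))

  ∑-mono-All : ∀ {P : A → Set p} {xs : List A} {f g} → (∀ {x} → P x → f x ≤ g x) → All P xs → ∑ xs f ≤ ∑ xs g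
  ∑-mono-All le []         = ℤ.≤-refl
  ∑-mono-All le (px ∷ pxs) = ℤ.+-mono-≤ (le px) (∑-mono-All le pxs)

  ∑-filter : ∀ {P : A → Set p} (P? : ∀ x → Dec (P x)) xs → ℤ.+ length (filter P? xs) ≡ ∑ xs (λ x → [ P? x ])
  ∑-filter P? [] = refl
  ∑-filter P? (x ∷ xs) with P? x
  ... | yes _ = cong (1ℤ +_) (∑-filter P? xs)
  ... | no _  = trans (∑-filter P? xs) (sym (ℤ.+-identityˡ _))

  ∑-cartesianProduct : ∀ (xs : List A) (ys : List B) {f} →
                       ∑ (cartesianProduct xs ys) f ≡ ∑ xs (λ x → ∑ ys (λ y → f (x , y)))
  ∑-cartesianProduct []       ys     = refl
  ∑-cartesianProduct (x ∷ xs) ys {f} = trans (∑-++ (map (x ,_) ys) _)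
    (cong₂ _+_ (∑-map (x ,_) ys) (∑-cartesianProduct xs ys))

  ∑-Unique≤1 : (_≟_ : DecidableEquality A) → ∀ {xs} → Propositional.Unique xs → ∀ x → ∑ xs (λ y → [ x ≟ y ]) ≤ 1ℤ
  ∑-Unique≤1 _≟_ [] x = +≤+ ℕ.z≤n
  ∑-Unique≤1 _≟_ (_∷_ {y} {xs} y∉xs xs!) x with x ≟ y
  ... | no _     = ℤ.≤-trans (ℤ.≤-reflexive (ℤ.+-identityˡ _)) (∑-Unique≤1 _≟_ xs! x)
  ... | yes refl = ℤ.+-monoʳ-≤ 1ℤ (ℤ.≤-trans
    (∑-mono-All (λ {z} x≢z → ℤ.≤-reflexive ([]-false (x ≟ z) x≢z)) y∉xs)
    (ℤ.≤-reflexive (∑-zero xs)))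

  ∑-product : ∀ (xs : List A) (ys : List B) {f g} →
              ∑ xs f * ∑ ys g ≡ ∑ xs (λ x → ∑ ys (λ y → f x * g y))
  ∑-product xs ys {f} {g} =
    trans (sym (∑-*ʳ xs (∑ ys g))) (∑-cong xs (λ x → sym (∑-*ˡ ys (f x))))

  -- The tail of `allFin (suc n)` is `tabulate Fin.suc`, not a sum over `allFin n`; inductions on
  -- `n` pass through this conversion.
  ∑-tabulate : ∀ n (g : Fin n → A) {f} → ∑ (tabulate g) f ≡ ∑ (allFin n) (f ∘ g)
  ∑-tabulate zero g = refl
  ∑-tabulate (suc n) g {f} = cong (f (g Fin.zero) +_) (begin
    ∑ (tabulate (g ∘ Fin.suc)) f             ≡⟨ ∑-tabulate n (g ∘ Fin.suc) ⟩
    ∑ (allFin n) (f ∘ g ∘ Fin.suc)           ≡⟨ ∑-tabulate n Fin.suc ⟨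
    ∑ (tabulate Fin.suc) (f ∘ g)             ∎)
    where open ≡-Reasoning

  ∑-δ : ∀ n (y : Fin n) → ∑ (allFin n) (λ x → [ x Fin.≟ y ]) ≡ 1ℤ
  ∑-δ (suc n) Fin.zero = begin
    1ℤ + ∑ (tabulate Fin.suc) (λ x → [ x Fin.≟ Fin.zero {n} ])
      ≡⟨ cong (1ℤ +_) (∑-tabulate n Fin.suc {λ x → [ x Fin.≟ Fin.zero {n} ]}) ⟩
    1ℤ + ∑ (allFin n) (λ x → 0ℤ)                             ≡⟨ cong (1ℤ +_) (∑-zero (allFin n)) ⟩
    1ℤ                                                       ∎
    where open ≡-Reasoning
  ∑-δ (suc n) (Fin.suc y) = begin
    0ℤ + ∑ (tabulate Fin.suc) (λ x → [ x Fin.≟ Fin.suc y ])  ≡⟨ ℤ.+-identityˡ _ ⟩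
    ∑ (tabulate Fin.suc) (λ x → [ x Fin.≟ Fin.suc y ])       ≡⟨ ∑-tabulate n Fin.suc ⟩
    ∑ (allFin n) (λ x → [ Fin.suc x Fin.≟ Fin.suc y ])
      ≡⟨ ∑-cong (allFin n) (λ x → []-cong (Fin.suc x Fin.≟ Fin.suc y) (x Fin.≟ y) Fin.suc-injective (cong Fin.suc)) ⟩
    ∑ (allFin n) (λ x → [ x Fin.≟ y ])                       ≡⟨ ∑-δ n y ⟩
    1ℤ                                                       ∎
    where open ≡-Reasoning

  -- That each element is listed exactly once is expressed by a sum of indicators: sifting uses it
  -- in this form, and it multiplies from coordinates to vectors.
  record Enumeration (A : Set a) : Set a where
    infix 4 _≟_
    field
      _≟_      : DecidableEquality A
      elements : List A
      ∑-≟      : ∀ y → ∑ elements (λ x → [ x ≟ y ]) ≡ 1ℤ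

    ∑-sift : ∀ y f → ∑ elements (λ x → [ x ≟ y ] * f x) ≡ f y
    ∑-sift y f = begin
      ∑ elements (λ x → [ x ≟ y ] * f x)  ≡⟨ ∑-cong elements pointwise ⟩
      ∑ elements (λ x → [ x ≟ y ] * f y)  ≡⟨ ∑-*ʳ elements (f y) ⟩
      ∑ elements (λ x → [ x ≟ y ]) * f y  ≡⟨ cong (_* f y) (∑-≟ y) ⟩
      1ℤ * f y                            ≡⟨ ℤ.*-identityˡ (f y) ⟩
      f y                                 ∎
      where
      open ≡-Reasoning
      pointwise : ∀ x → [ x ≟ y ] * f x ≡ [ x ≟ y ] * f y
      pointwise x with x ≟ y
      ... | yes refl = refl
      ... | no _     = refl

    ∑-unique : ∀ {P : A → Set p} (P? : ∀ x → Dec (P x)) y →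
               (∀ {x} → P x → x ≡ y) → P y → ∑ elements (λ x → [ P? x ]) ≡ 1ℤ
    ∑-unique P? y uniq Py =
      trans (∑-cong elements (λ x → []-cong (P? x) (x ≟ y) uniq (λ { refl → Py }))) (∑-≟ y)

    -- Expanding `f (σ x)` as a sifted sum over its argument `y` and exchanging the sums leaves the
    -- fibre sizes of `σ`, which are all one.
    ∑-reindex : ∀ (σ τ : A → A) → (∀ x → τ (σ x) ≡ x) → (∀ x → σ (τ x) ≡ x) →
                ∀ f → ∑ elements (f ∘ σ) ≡ ∑ elements f
    ∑-reindex σ τ τσ στ f = begin
      ∑ elements (f ∘ σ)
        ≡⟨ ∑-cong elements (λ x → ∑-sift (σ x) f) ⟨
      ∑ elements (λ x → ∑ elements (λ y → [ y ≟ σ x ] * f y))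
        ≡⟨ ∑-swap elements elements ⟩
      ∑ elements (λ y → ∑ elements (λ x → [ y ≟ σ x ] * f y))
        ≡⟨ ∑-cong elements (λ y → ∑-*ʳ elements (f y)) ⟩
      ∑ elements (λ y → ∑ elements (λ x → [ y ≟ σ x ]) * f y)
        ≡⟨ ∑-cong elements (λ y → cong (_* f y) (fibre y)) ⟩
      ∑ elements (λ y → 1ℤ * f y)
        ≡⟨ ∑-cong elements (λ y → ℤ.*-identityˡ (f y)) ⟩
      ∑ elements f
        ∎
      where
      open ≡-Reasoning
      fibre : ∀ y → ∑ elements (λ x → [ y ≟ σ x ]) ≡ 1ℤ
      fibre y = ∑-unique (λ x → y ≟ σ x) (τ y)
        (λ {x} y≡σx → sym (trans (cong τ y≡σx) (τσ x))) (sym (στ y))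

  Fin-enumeration : ∀ n → Enumeration (Fin n)
  Fin-enumeration n = record { _≟_ = Fin._≟_ ; elements = allFin n ; ∑-≟ = ∑-δ n }

  module _ {A : Set} (E : Enumeration A) where
    open Enumeration E

    private
      vectors : ∀ n → List (Vec A n)
      vectors zero    = [] ∷ []
      vectors (suc n) = concatMap (λ x → map (x ∷_) (vectors n)) elements

      _≟ⱽ_ : ∀ {n} → DecidableEquality (Vec A n)
      _≟ⱽ_ = Vec.≡-dec _≟_

    ∑-vectors-suc : ∀ n {f} → ∑ (vectors (suc n)) f ≡ ∑ elements (λ x → ∑ (vectors n) (λ xs → f (x ∷ xs)))
    ∑-vectors-suc n {f} = begin
      ∑ (vectors (suc n)) f                                   ≡⟨ ∑-concatMap (λ x → map (x ∷_) (vectors n)) elements ⟩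
      ∑ elements (λ x → ∑ (map (x ∷_) (vectors n)) f)         ≡⟨ ∑-cong elements (λ x → ∑-map (x ∷_) (vectors n)) ⟩
      ∑ elements (λ x → ∑ (vectors n) (λ xs → f (x ∷ xs)))    ∎
      where open ≡-Reasoning

    private
      []-∷ : ∀ {n} x y (xs ys : Vec A n) → [ (x ∷ xs) ≟ⱽ (y ∷ ys) ] ≡ [ x ≟ y ] * [ xs ≟ⱽ ys ]
      []-∷ x y xs ys with x ≟ y | xs ≟ⱽ ys
      ... | yes _ | yes _ = refl
      ... | yes _ | no _  = refl
      ... | no _  | yes _ = refl
      ... | no _  | no _  = refl

      ∑-≟ⱽ : ∀ n (y : Vec A n) → ∑ (vectors n) (λ x → [ x ≟ⱽ y ]) ≡ 1ℤ
      ∑-≟ⱽ zero    []       = refl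
      ∑-≟ⱽ (suc n) (y ∷ ys) = begin
        ∑ (vectors (suc n)) (λ x → [ x ≟ⱽ (y ∷ ys) ])                             ≡⟨ ∑-vectors-suc n ⟩
        ∑ elements (λ x → ∑ (vectors n) (λ xs → [ (x ∷ xs) ≟ⱽ (y ∷ ys) ]))
          ≡⟨ ∑-cong elements (λ x → ∑-cong (vectors n) (λ xs → []-∷ x y xs ys)) ⟩
        ∑ elements (λ x → ∑ (vectors n) (λ xs → [ x ≟ y ] * [ xs ≟ⱽ ys ]))         ≡⟨ ∑-product elements (vectors n) ⟨
        ∑ elements (λ x → [ x ≟ y ]) * ∑ (vectors n) (λ xs → [ xs ≟ⱽ ys ])         ≡⟨ cong₂ _*_ (∑-≟ y) (∑-≟ⱽ n ys) ⟩
        1ℤ                                                                        ∎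
        where open ≡-Reasoning

    Vec-enumeration : ∀ n → Enumeration (Vec A n)
    Vec-enumeration n = record { _≟_ = _≟ⱽ_ ; elements = vectors n ; ∑-≟ = ∑-≟ⱽ n }

open FiniteSums

-- A field carried by a type with propositional equality: on `Fin q`, hypotheses rewrite by `cong`
-- and the elements are enumerated by `allFin`.
record FieldOn (A : Set) : Set where
  infixl 6 _⊕_ _⊝_
  infixl 7 _⊗_
  infix  8 ⊖_
  field
    _⊕_ _⊗_           : A → A → A
    ⊖_                : A → A
    𝟘 𝟙               : A
    isCommutativeRing : IsCommutativeRing _≡_ _⊕_ _⊗_ ⊖_ 𝟘 𝟙
    𝟙≢𝟘               : 𝟙 ≢ 𝟘
    invertible        : ∀ {x} → x ≢ 𝟘 → ∃[ y ] y ⊗ x ≡ 𝟙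

  commutativeRing : CommutativeRing _ _
  commutativeRing = record { isCommutativeRing = isCommutativeRing }

  _⊝_ : A → A → A
  x ⊝ y = x ⊕ ⊖ y

-- Square roots and conics over a field with q ≡ 3 (mod 4).

module Counting {q : ℕ} (F : FieldOn (Fin q)) (q%4≡3 : q ℕ.% 4 ≡ 3) where
  open import Data.Integer.Base using (_+_; _*_; _-_; -_; _≤_; +≤+)
  open FieldOn F
  open IntegerCoefficients commutativeRing
  open CommutativeRing commutativeRing
    using (+-identityˡ; +-identityʳ; +-assoc; -‿inverseˡ; -‿inverseʳ; zeroˡ; zeroʳ)
    renaming (*-assoc to ⊗-assoc; *-identityˡ to ⊗-identityˡ; *-identityʳ to ⊗-identityʳ)
  open Enumeration (Fin-enumeration q) renaming (elements to Fₑ)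

  qℤ : ℤ
  qℤ = ℤ.+ q

  δ : Fin q → ℤ
  δ x = [ x ≟ 𝟘 ]

  ⊗-cancelˡ-𝟘 : ∀ {k x} → k ≢ 𝟘 → k ⊗ x ≡ 𝟘 → x ≡ 𝟘
  ⊗-cancelˡ-𝟘 {k} {x} k≢0 kx≡0 with (u , uk≡1) ← invertible k≢0 = begin
    x              ≡⟨ ⊗-identityˡ x ⟨
    𝟙 ⊗ x          ≡⟨ cong (_⊗ x) uk≡1 ⟨
    u ⊗ k ⊗ x      ≡⟨ ⊗-assoc u k x ⟩
    u ⊗ (k ⊗ x)    ≡⟨ cong (u ⊗_) kx≡0 ⟩
    u ⊗ 𝟘          ≡⟨ zeroʳ u ⟩
    𝟘              ∎
    where open ≡-Reasoning

  ⊗-≢𝟘 : ∀ {x y} → x ≢ 𝟘 → y ≢ 𝟘 → x ⊗ y ≢ 𝟘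
  ⊗-≢𝟘 x≢0 y≢0 xy≡0 = y≢0 (⊗-cancelˡ-𝟘 x≢0 xy≡0)

  ⊝≡𝟘⇒≡ : ∀ {x y} → x ⊝ y ≡ 𝟘 → x ≡ y
  ⊝≡𝟘⇒≡ {x} {y} x-y≡0 = begin
    x            ≡⟨ solve 2 (λ x y → x := (x :- y) :+ y) refl x y ⟩
    x ⊝ y ⊕ y    ≡⟨ cong (_⊕ y) x-y≡0 ⟩
    𝟘 ⊕ y        ≡⟨ +-identityˡ y ⟩
    y            ∎
    where open ≡-Reasoning

  ⊖≢𝟘 : ∀ {x} → x ≢ 𝟘 → ⊖ x ≢ 𝟘
  ⊖≢𝟘 {x} x≢0 -x≡0 = x≢0 (trans (trans (solve 1 (λ x → x := :- (:- x)) refl x) (cong ⊖_ -x≡0))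
    (solve 0 (:- con 0ℤ := con 0ℤ) refl))

  ⊝-≢𝟘 : ∀ {x y} → x ≢ y → x ⊝ y ≢ 𝟘
  ⊝-≢𝟘 x≢y eq = x≢y (⊝≡𝟘⇒≡ eq)

  δ-𝟘 : δ 𝟘 ≡ 1ℤ
  δ-𝟘 = []-true (𝟘 ≟ 𝟘) refl

  δ-≢ : ∀ {x} → x ≢ 𝟘 → δ x ≡ 0ℤ
  δ-≢ {x} = []-false (x ≟ 𝟘)

  δ-scale : ∀ {k} x → k ≢ 𝟘 → δ (k ⊗ x) ≡ δ x
  δ-scale {k} x k≢0 = []-cong (k ⊗ x ≟ 𝟘) (x ≟ 𝟘) (⊗-cancelˡ-𝟘 k≢0) (λ { refl → zeroʳ k })

  length-Fₑ : length Fₑ ≡ q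
  length-Fₑ = List.length-tabulate (λ i → i)

  ∑-one : ∑ Fₑ (λ _ → 1ℤ) ≡ qℤ
  ∑-one = trans (∑-1 Fₑ) (cong ℤ.+_ length-Fₑ)

  ∑-constF : ∀ k → ∑ Fₑ (λ _ → k) ≡ qℤ * k
  ∑-constF k = trans (∑-const Fₑ k) (cong (λ n → ℤ.+ n * k) length-Fₑ)

  ∑-shift : ∀ y (f : Fin q → ℤ) → ∑ Fₑ (λ x → f (x ⊕ y)) ≡ ∑ Fₑ f
  ∑-shift y = ∑-reindex (_⊕ y) (_⊝ y)
    (solve 2 (λ y x → (x :+ y) :- y := x) refl y)
    (solve 2 (λ y x → (x :- y) :+ y := x) refl y)

  δ-sum : ∑ Fₑ δ ≡ 1ℤ
  δ-sum = ∑-≟ 𝟘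

  ∑-⊝ : ∀ y → ∑ Fₑ (λ x → δ (x ⊝ y)) ≡ 1ℤ
  ∑-⊝ y = ∑-unique (λ x → x ⊝ y ≟ 𝟘) y ⊝≡𝟘⇒≡ (-‿inverseʳ y)

  ∑-linear : ∀ A {B} → B ≢ 𝟘 → ∑ Fₑ (λ c → δ (A ⊕ c ⊗ B)) ≡ 1ℤ
  ∑-linear A {B} B≢0 with (u , uB≡1) ← invertible B≢0 =
    trans (∑-cong Fₑ (λ c → trans (sym (δ-scale (A ⊕ c ⊗ B) u≢0)) (cong δ (monic c)))) (∑-⊝ (⊖ (u ⊗ A)))
    where
    open ≡-Reasoning
    u≢0 : u ≢ 𝟘
    u≢0 refl = 𝟙≢𝟘 (trans (sym uB≡1) (zeroˡ B))
    monic : ∀ c → u ⊗ (A ⊕ c ⊗ B) ≡ c ⊝ ⊖ (u ⊗ A)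
    monic c = begin
      u ⊗ (A ⊕ c ⊗ B)           ≡⟨ solve 4 (λ u a b c → u :* (a :+ c :* b) := c :* (u :* b) :- (:- (u :* a))) refl u A B c ⟩
      c ⊗ (u ⊗ B) ⊝ ⊖ (u ⊗ A)   ≡⟨ cong (λ z → c ⊗ z ⊝ ⊖ (u ⊗ A)) uB≡1 ⟩
      c ⊗ 𝟙 ⊝ ⊖ (u ⊗ A)         ≡⟨ cong (_⊝ ⊖ (u ⊗ A)) (⊗-identityʳ c) ⟩
      c ⊝ ⊖ (u ⊗ A)             ∎

  -- Two-element orbits of the involution contribute the same value twice and fixed points
  -- contribute nothing; the order on `Fin q` picks one representative of each orbit.
  ∑-even : ∀ (σ : Fin q → Fin q) → (∀ x → σ (σ x) ≡ x) →
           (f : Fin q → ℤ) → (∀ x → f (σ x) ≡ f x) → (∀ x → σ x ≡ x → f x ≡ 0ℤ) →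
           ∃[ k ] ∑ Fₑ f ≡ k + k
  ∑-even σ σσ f fσ fix = ∑ Fₑ g , (begin
    ∑ Fₑ f                        ≡⟨ ∑-cong Fₑ split ⟩
    ∑ Fₑ (λ x → g x + g (σ x))    ≡⟨ ∑-+ Fₑ ⟩
    ∑ Fₑ g + ∑ Fₑ (g ∘ σ)         ≡⟨ cong (∑ Fₑ g +_) (∑-reindex σ σ σσ σσ g) ⟩
    ∑ Fₑ g + ∑ Fₑ g               ∎)
    where
    open ≡-Reasoning
    g : Fin q → ℤ
    g x = [ x Fin.<? σ x ] * f x
    g-< : ∀ x → x Fin.< σ x → g x ≡ f x
    g-< x lt = trans (cong (_* f x) ([]-true (x Fin.<? σ x) lt)) (ℤ.*-identityˡ (f x))
    g-≮ : ∀ x → ¬ x Fin.< σ x → g x ≡ 0ℤ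
    g-≮ x ≮ = cong (_* f x) ([]-false (x Fin.<? σ x) ≮)
    split : ∀ x → f x ≡ g x + g (σ x)
    split x with Fin.<-cmp x (σ x)
    ... | tri< lt _ ≯ = sym (trans (cong₂ _+_ (g-< x lt) (g-≮ (σ x) (λ σx<x → ≯ (subst (σ x Fin.<_) (σσ x) σx<x)))) (ℤ.+-identityʳ (f x)))
    ... | tri≈ ≮ eq _ = trans (fix x (sym eq)) (sym (cong₂ _+_ (g-≮ x ≮) (g-≮ (σ x) (λ σx<x → ≮ (subst₂ Fin._<_ (sym eq) (trans (σσ x) eq) σx<x)))))
    ... | tri> ≮ _ gt = sym (trans (cong₂ _+_ (g-≮ x ≮) (trans (g-< (σ x) (subst (σ x Fin.<_) (sym (σσ x)) gt)) (fσ x))) (ℤ.+-identityˡ (f x)))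

  q≡3+4m : ∃[ m ] qℤ ≡ ℤ.+ 3 + (m + m + (m + m))
  q≡3+4m = m , (begin
    qℤ                                 ≡⟨ cong ℤ.+_ (trans (ℕ.m≡m%n+[m/n]*n q 4) (cong (ℕ._+ q ℕ./ 4 ℕ.* 4) q%4≡3)) ⟩
    ℤ.+ 3 + ℤ.+ (q ℕ./ 4 ℕ.* 4)        ≡⟨ cong (ℤ.+ 3 +_) (ℤ.pos-* (q ℕ./ 4) 4) ⟩
    ℤ.+ 3 + m * ℤ.+ 4                  ≡⟨ lemma m ⟩
    ℤ.+ 3 + (m + m + (m + m))          ∎)
    where
    open ≡-Reasoning
    m = ℤ.+ (q ℕ./ 4)
    lemma : ∀ m → ℤ.+ 3 + m * ℤ.+ 4 ≡ ℤ.+ 3 + (m + m + (m + m))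
    lemma = solve-∀

  -- In characteristic two, translation by `𝟙` would pair off the elements without fixed points, and
  -- q would be even.
  𝟙⊕𝟙≢𝟘 : 𝟙 ⊕ 𝟙 ≢ 𝟘
  𝟙⊕𝟙≢𝟘 2≡0 with ∑-even (_⊕ 𝟙) twice (λ _ → 1ℤ) (λ _ → refl) no-fix | q≡3+4m
    where
    twice : ∀ x → x ⊕ 𝟙 ⊕ 𝟙 ≡ x
    twice x = trans (+-assoc x 𝟙 𝟙) (trans (cong (x ⊕_) 2≡0) (+-identityʳ x))
    no-fix : ∀ x → x ⊕ 𝟙 ≡ x → 1ℤ ≡ 0ℤ
    no-fix x eq = ⊥-elim (𝟙≢𝟘 (trans (solve 1 (λ x → con 1ℤ := (x :+ con 1ℤ) :- x) refl x)
      (trans (cong (_⊝ x) eq) (-‿inverseʳ x))))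
  -- From 2k = 3 + 4m the integer k - 2m - 1 would be one half.
  ... | k , 2k | m , 4m = i+i≢1 (k - (m + m) - 1ℤ) (trans (lemma₁ k m) (trans (cong (_- (ℤ.+ 2 + (m + m + (m + m)))) k+k) (lemma₂ m)))
    where
    k+k : k + k ≡ ℤ.+ 3 + (m + m + (m + m))
    k+k = trans (sym 2k) (trans ∑-one 4m)
    lemma₁ : ∀ k m → (k - (m + m) - 1ℤ) + (k - (m + m) - 1ℤ) ≡ (k + k) - (ℤ.+ 2 + (m + m + (m + m)))
    lemma₁ = solve-∀
    lemma₂ : ∀ m → (ℤ.+ 3 + (m + m + (m + m))) - (ℤ.+ 2 + (m + m + (m + m))) ≡ 1ℤ
    lemma₂ = solve-∀

  ⊕-self-≢𝟘 : ∀ {x} → x ≢ 𝟘 → x ⊕ x ≢ 𝟘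
  ⊕-self-≢𝟘 {x} x≢0 2x≡0 = x≢0 (⊗-cancelˡ-𝟘 𝟙⊕𝟙≢𝟘
    (trans (solve 1 (λ x → (con 1ℤ :+ con 1ℤ) :* x := x :+ x) refl x) 2x≡0))

  IsSquare : Fin q → Set
  IsSquare r = ∃[ t ] t ⊗ t ≡ r

  isSquare? : ∀ r → Dec (IsSquare r)
  isSquare? r = Fin.any? (λ t → t ⊗ t ≟ r)

  roots : Fin q → ℤ
  roots r = ∑ Fₑ (λ b → δ (b ⊗ b ⊝ r))

  roots-𝟘 : roots 𝟘 ≡ 1ℤ
  roots-𝟘 = ∑-unique (λ b → b ⊗ b ⊝ 𝟘 ≟ 𝟘) 𝟘 unique (solve 0 (con 0ℤ :* con 0ℤ :- con 0ℤ := con 0ℤ) refl)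
    where
    unique : ∀ {b} → b ⊗ b ⊝ 𝟘 ≡ 𝟘 → b ≡ 𝟘
    unique {b} eq with b ≟ 𝟘
    ... | yes b≡0 = b≡0
    ... | no b≢0 = ⊗-cancelˡ-𝟘 b≢0 (⊝≡𝟘⇒≡ eq)

  -- The factors of b² - t² = (b - t)(b + t) never vanish together, because t ≠ -t in odd
  -- characteristic; the indicators therefore add.
  roots-square : ∀ {r} → IsSquare r → r ≢ 𝟘 → roots r ≡ ℤ.+ 2
  roots-square (t , refl) t²≢0 = begin
    ∑ Fₑ (λ b → δ (b ⊗ b ⊝ t ⊗ t))                       ≡⟨ ∑-cong Fₑ factor ⟩
    ∑ Fₑ (λ b → δ (b ⊝ t) + δ (b ⊝ ⊖ t))                 ≡⟨ ∑-+ Fₑ ⟩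
    ∑ Fₑ (λ b → δ (b ⊝ t)) + ∑ Fₑ (λ b → δ (b ⊝ ⊖ t))    ≡⟨ cong₂ _+_ (∑-⊝ t) (∑-⊝ (⊖ t)) ⟩
    ℤ.+ 2                                                ∎
    where
    open ≡-Reasoning
    t≢0 : t ≢ 𝟘
    t≢0 refl = t²≢0 (zeroˡ 𝟘)
    factor : ∀ b → δ (b ⊗ b ⊝ t ⊗ t) ≡ δ (b ⊝ t) + δ (b ⊝ ⊖ t)
    factor b with b ≟ t
    ... | yes refl = trans (trans (cong δ (-‿inverseʳ (t ⊗ t))) δ-𝟘) (sym (cong₂ _+_
            (trans (cong δ (-‿inverseʳ t)) δ-𝟘)
            (δ-≢ (λ eq → ⊕-self-≢𝟘 t≢0 (trans (solve 1 (λ t → t :+ t := t :- (:- t)) refl t) eq)))))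
    ... | no b≢t = begin
      δ (b ⊗ b ⊝ t ⊗ t)          ≡⟨ cong δ (solve 2 (λ b t → b :* b :- t :* t := (b :- t) :* (b :- (:- t))) refl b t) ⟩
      δ ((b ⊝ t) ⊗ (b ⊝ ⊖ t))    ≡⟨ δ-scale (b ⊝ ⊖ t) (⊝-≢𝟘 b≢t) ⟩
      δ (b ⊝ ⊖ t)                ≡⟨ ℤ.+-identityˡ _ ⟨
      0ℤ + δ (b ⊝ ⊖ t)           ≡⟨ cong (_+ δ (b ⊝ ⊖ t)) (δ-≢ (⊝-≢𝟘 b≢t)) ⟨
      δ (b ⊝ t) + δ (b ⊝ ⊖ t)    ∎

  roots-nonsquare : ∀ {r} → ¬ IsSquare r → roots r ≡ 0ℤ
  roots-nonsquare ¬sq = trans (∑-cong Fₑ (λ b → δ-≢ (λ eq → ¬sq (b , ⊝≡𝟘⇒≡ eq)))) (∑-zero Fₑ)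

  -- Double counting: every b is a square root of exactly one r.
  ∑-roots : ∑ Fₑ roots ≡ qℤ
  ∑-roots = begin
    ∑ Fₑ (λ r → ∑ Fₑ (λ b → δ (b ⊗ b ⊝ r)))   ≡⟨ ∑-swap Fₑ Fₑ ⟩
    ∑ Fₑ (λ b → ∑ Fₑ (λ r → δ (b ⊗ b ⊝ r)))
      ≡⟨ ∑-cong Fₑ (λ b → ∑-unique (λ r → b ⊗ b ⊝ r ≟ 𝟘) (b ⊗ b) (λ eq → sym (⊝≡𝟘⇒≡ eq)) (-‿inverseʳ (b ⊗ b))) ⟩
    ∑ Fₑ (λ b → 1ℤ)                           ≡⟨ ∑-one ⟩
    qℤ                                        ∎
    where open ≡-Reasoning

  -- If −1 were a square, the nonzero squares would be permuted freely by
  -- negation; their number (q − 1)/2 is odd.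
  ⊖𝟙-nonsquare : ¬ IsSquare (⊖ 𝟙)
  ⊖𝟙-nonsquare (i , i²≡-1) = impossible (∑-even ⊖_ ⊖⊖ s s-⊖ s-fix) q≡3+4m
    where
    ⊖⊖ : ∀ x → ⊖ (⊖ x) ≡ x
    ⊖⊖ = solve 1 (λ x → :- (:- x) := x) refl
    s : Fin q → ℤ
    s r = [ isSquare? r ] - δ r
    ⊖-square : ∀ {r} → IsSquare r → IsSquare (⊖ r)
    ⊖-square (t , refl) = i ⊗ t , trans (solve 2 (λ i t → i :* t :* (i :* t) := i :* i :* (t :* t)) refl i t)
      (trans (cong (_⊗ (t ⊗ t)) i²≡-1) (solve 1 (λ t → (:- con 1ℤ) :* t := :- t) refl (t ⊗ t)))
    s-⊖ : ∀ r → s (⊖ r) ≡ s r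
    s-⊖ r = cong₂ _-_
      ([]-cong (isSquare? (⊖ r)) (isSquare? r) (λ sq → subst IsSquare (⊖⊖ r) (⊖-square sq)) ⊖-square)
      ([]-cong (⊖ r ≟ 𝟘) (r ≟ 𝟘) (λ eq → trans (sym (⊖⊖ r)) (trans (cong ⊖_ eq) (solve 0 (:- con 0ℤ := con 0ℤ) refl)))
        (λ { refl → solve 0 (:- con 0ℤ := con 0ℤ) refl }))
    s-fix : ∀ r → ⊖ r ≡ r → s r ≡ 0ℤ
    s-fix r -r≡r with r ≟ 𝟘
    ... | yes refl = cong (_- 1ℤ) ([]-true (isSquare? 𝟘) (𝟘 , zeroˡ 𝟘))
    ... | no r≢0   = ⊥-elim (⊕-self-≢𝟘 r≢0 (trans (cong (_⊕ r) (sym -r≡r)) (-‿inverseˡ r)))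
    roots-s : ∀ r → roots r ≡ δ r + (s r + s r)
    roots-s r with r ≟ 𝟘
    ... | yes refl = trans roots-𝟘 (sym (cong (λ n → 1ℤ + (n - 1ℤ + (n - 1ℤ))) ([]-true (isSquare? 𝟘) (𝟘 , zeroˡ 𝟘))))
    ... | no r≢0 with isSquare? r
    ...   | yes sq = roots-square sq r≢0
    ...   | no ¬sq = roots-nonsquare ¬sq
    impossible : ∃[ k ] ∑ Fₑ s ≡ k + k → ∃[ m ] qℤ ≡ ℤ.+ 3 + (m + m + (m + m)) → ⊥
    -- Summing `roots-s` gives q = 1 + 2 · 2k; against q = 3 + 4m, the integer k - m would be one
    -- half.
    impossible (k , 2k) (m , 4m) = i+i≢1 (k - m) (ℤ.*-cancelˡ-≡ (ℤ.+ 2) ((k - m) + (k - m)) 1ℤ (begin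
      ℤ.+ 2 * ((k - m) + (k - m))                               ≡⟨ lemma₁ k m ⟩
      1ℤ + ((k + k) + (k + k)) - (1ℤ + (m + m + (m + m)))       ≡⟨ cong (_- (1ℤ + (m + m + (m + m)))) q-odd ⟩
      ℤ.+ 3 + (m + m + (m + m)) - (1ℤ + (m + m + (m + m)))      ≡⟨ lemma₂ m ⟩
      ℤ.+ 2                                                     ∎))
      where
      open ≡-Reasoning
      q-odd : 1ℤ + ((k + k) + (k + k)) ≡ ℤ.+ 3 + (m + m + (m + m))
      q-odd = begin
        1ℤ + ((k + k) + (k + k))                    ≡⟨ cong₂ (λ x y → x + (y + y)) δ-sum 2k ⟨
        ∑ Fₑ δ + (∑ Fₑ s + ∑ Fₑ s)                  ≡⟨ cong (∑ Fₑ δ +_) (∑-+ Fₑ) ⟨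
        ∑ Fₑ δ + ∑ Fₑ (λ r → s r + s r)             ≡⟨ ∑-+ Fₑ ⟨
        ∑ Fₑ (λ r → δ r + (s r + s r))              ≡⟨ ∑-cong Fₑ roots-s ⟨
        ∑ Fₑ roots                                  ≡⟨ trans ∑-roots 4m ⟩
        ℤ.+ 3 + (m + m + (m + m))                   ∎
      lemma₁ : ∀ k m → ℤ.+ 2 * ((k - m) + (k - m)) ≡ 1ℤ + ((k + k) + (k + k)) - (1ℤ + (m + m + (m + m)))
      lemma₁ = solve-∀
      lemma₂ : ∀ m → ℤ.+ 3 + (m + m + (m + m)) - (1ℤ + (m + m + (m + m))) ≡ ℤ.+ 2
      lemma₂ = solve-∀

  roots≤2 : ∀ r → r ≢ 𝟘 → roots r ≤ ℤ.+ 2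
  roots≤2 r r≢0 with isSquare? r
  ... | yes sq = ℤ.≤-reflexive (roots-square sq r≢0)
  ... | no ¬sq = ℤ.≤-trans (ℤ.≤-reflexive (roots-nonsquare ¬sq)) (+≤+ ℕ.z≤n)

  -- Each pair ±r has at most two square roots in total; summing over r, the
  -- deficits add up to zero.
  roots-± : ∀ r → roots r + roots (⊖ r) ≡ ℤ.+ 2
  roots-± r = sym (ℤ.i-j≡0⇒i≡j (ℤ.+ 2) _ (ℤ.≤-antisym
    (subst (deficit r ≤_) ∑-deficit (∑-∈ 0≤deficit (∈-allFin r)))
    (0≤deficit r)))
    where
    deficit : Fin q → ℤ
    deficit r = ℤ.+ 2 - (roots r + roots (⊖ r))

    square-both : ∀ {r} → r ≢ 𝟘 → IsSquare r → ¬ IsSquare (⊖ r)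
    square-both t²≢0 (t , refl) (v , v²≡-t²) with (u , ut≡1) ← invertible {t} (λ { refl → t²≢0 (zeroˡ 𝟘) }) =
      -- Here `u` inverts t, so the witness is v / t, with square -t² / t² = -1.
      ⊖𝟙-nonsquare (u ⊗ v , (begin
        u ⊗ v ⊗ (u ⊗ v)            ≡⟨ solve 2 (λ u v → u :* v :* (u :* v) := u :* u :* (v :* v)) refl u v ⟩
        u ⊗ u ⊗ (v ⊗ v)            ≡⟨ cong (u ⊗ u ⊗_) v²≡-t² ⟩
        u ⊗ u ⊗ (⊖ (t ⊗ t))        ≡⟨ solve 2 (λ u t → u :* u :* (:- (t :* t)) := :- (u :* t :* (u :* t))) refl u t ⟩
        ⊖ (u ⊗ t ⊗ (u ⊗ t))        ≡⟨ cong (λ z → ⊖ (z ⊗ z)) ut≡1 ⟩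
        ⊖ (𝟙 ⊗ 𝟙)                  ≡⟨ solve 0 (:- (con 1ℤ :* con 1ℤ) := :- con 1ℤ) refl ⟩
        ⊖ 𝟙                        ∎))
      where open ≡-Reasoning

    0≤deficit : ∀ r → 0ℤ ≤ deficit r
    0≤deficit r with r ≟ 𝟘
    ... | yes refl = ℤ.≤-reflexive (sym (cong₂ (λ x y → ℤ.+ 2 - (x + y)) roots-𝟘
            (trans (cong roots (solve 0 (:- con 0ℤ := con 0ℤ) refl)) roots-𝟘)))
    ... | no r≢0 with isSquare? r
    ...   | yes sq = ℤ.≤-reflexive (sym (cong₂ (λ x y → ℤ.+ 2 - (x + y)) (roots-square sq r≢0)
              (roots-nonsquare (square-both r≢0 sq))))
    ...   | no ¬sq = ℤ.i≤j⇒0≤j-i (subst (λ x → x + roots (⊖ r) ≤ ℤ.+ 2) (sym (roots-nonsquare ¬sq))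
              (subst (_≤ ℤ.+ 2) (sym (ℤ.+-identityˡ _)) (roots≤2 (⊖ r) (⊖≢𝟘 r≢0))))

    ∑-deficit : ∑ Fₑ deficit ≡ 0ℤ
    ∑-deficit = begin
      ∑ Fₑ deficit                                                       ≡⟨ ∑-- Fₑ ⟩
      ∑ Fₑ (λ _ → ℤ.+ 2) - ∑ Fₑ (λ r → roots r + roots (⊖ r))            ≡⟨ cong₂ _-_ (∑-constF (ℤ.+ 2)) (∑-+ Fₑ) ⟩
      qℤ * ℤ.+ 2 - (∑ Fₑ roots + ∑ Fₑ (roots ∘ ⊖_))
        ≡⟨ cong (λ z → qℤ * ℤ.+ 2 - (∑ Fₑ roots + z)) (∑-reindex ⊖_ ⊖_ ⊖⊖ ⊖⊖ roots) ⟩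
      qℤ * ℤ.+ 2 - (∑ Fₑ roots + ∑ Fₑ roots)                             ≡⟨ cong (λ z → qℤ * ℤ.+ 2 - (z + z)) ∑-roots ⟩
      qℤ * ℤ.+ 2 - (qℤ + qℤ)                                             ≡⟨ lemma qℤ ⟩
      0ℤ                                                                 ∎
      where
      open ≡-Reasoning
      ⊖⊖ : ∀ x → ⊖ (⊖ x) ≡ x
      ⊖⊖ = solve 1 (λ x → :- (:- x) := x) refl
      lemma : ∀ q → q * ℤ.+ 2 - (q + q) ≡ 0ℤ
      lemma = solve-∀

  -- By `roots-±` the pair ±r has two roots in total; if `r` has none, they belong to -r. This
  -- supplies the t with r = -t² for a nonsquare radius.
  nonsquare⇒⊖square : ∀ {r} → ¬ IsSquare r → IsSquare (⊖ r)
  nonsquare⇒⊖square {r} ¬sq with isSquare? (⊖ r)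
  ... | yes sq = sq
  ... | no ¬sq′ with trans (sym (roots-± r)) (cong₂ _+_ (roots-nonsquare ¬sq) (roots-nonsquare ¬sq′))
  ...   | ()

  -- Through `roots-±` the conic a² + b² = s is the complement of the hyperbola a² - b² = s, which
  -- splits into linear factors and is easy to count. The result is q + 1 points, but only the
  -- origin when s = 0.
  ∑-sum-of-two-squares : ∀ s → ∑ Fₑ (λ a → ∑ Fₑ (λ b → δ (b ⊗ b ⊝ (s ⊝ a ⊗ a)))) ≡ qℤ + 1ℤ - qℤ * δ s
  ∑-sum-of-two-squares s = begin
    ∑ Fₑ (λ a → roots (s ⊝ a ⊗ a))                     ≡⟨ ∑-cong Fₑ reflect ⟩
    ∑ Fₑ (λ a → ℤ.+ 2 - roots (a ⊗ a ⊝ s))             ≡⟨ trans (∑-- Fₑ) (cong (_- hyperbola) (∑-constF (ℤ.+ 2))) ⟩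
    qℤ * ℤ.+ 2 - hyperbola                             ≡⟨ cong (λ z → qℤ * ℤ.+ 2 - z) ∑-hyperbola ⟩
    qℤ * ℤ.+ 2 - (qℤ - 1ℤ + qℤ * δ s)                  ≡⟨ lemma qℤ (δ s) ⟩
    qℤ + 1ℤ - qℤ * δ s                                 ∎
    where
    open ≡-Reasoning
    hyperbola : ℤ
    hyperbola = ∑ Fₑ (λ a → roots (a ⊗ a ⊝ s))
    reflect : ∀ a → roots (s ⊝ a ⊗ a) ≡ ℤ.+ 2 - roots (a ⊗ a ⊝ s)
    reflect a = begin
      roots (s ⊝ a ⊗ a)                                                          ≡⟨ add-sub (roots (a ⊗ a ⊝ s)) _ ⟩
      roots (a ⊗ a ⊝ s) + roots (s ⊝ a ⊗ a) - roots (a ⊗ a ⊝ s)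
        ≡⟨ cong (λ z → roots (a ⊗ a ⊝ s) + roots z - roots (a ⊗ a ⊝ s)) (solve 2 (λ s a → s :- a :* a := :- (a :* a :- s)) refl s a) ⟩
      roots (a ⊗ a ⊝ s) + roots (⊖ (a ⊗ a ⊝ s)) - roots (a ⊗ a ⊝ s)
        ≡⟨ cong (_- roots (a ⊗ a ⊝ s)) (roots-± (a ⊗ a ⊝ s)) ⟩
      ℤ.+ 2 - roots (a ⊗ a ⊝ s)                                                  ∎
      where
      add-sub : ∀ x y → y ≡ x + y - x
      add-sub = solve-∀
    slope : ∀ u → ∑ Fₑ (λ b → δ ((u ⊗ u ⊝ s) ⊕ b ⊗ (u ⊕ u))) ≡ 1ℤ - δ u + qℤ * δ s * δ u
    slope u with u ≟ 𝟘
    -- The slope 2u vanishes here and the equation reads -s = 0: it holds for every b or for none.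
    ... | yes refl = begin
      ∑ Fₑ (λ b → δ ((𝟘 ⊗ 𝟘 ⊝ s) ⊕ b ⊗ (𝟘 ⊕ 𝟘)))
        ≡⟨ ∑-cong Fₑ (λ b → cong δ (solve 2 (λ s b → (con 0ℤ :* con 0ℤ :- s) :+ b :* (con 0ℤ :+ con 0ℤ) := (:- con 1ℤ) :* s) refl s b)) ⟩
      ∑ Fₑ (λ b → δ (⊖ 𝟙 ⊗ s))                      ≡⟨ ∑-constF _ ⟩
      qℤ * δ (⊖ 𝟙 ⊗ s)                              ≡⟨ cong (qℤ *_) (δ-scale s (⊖≢𝟘 𝟙≢𝟘)) ⟩
      qℤ * δ s                                      ≡⟨ ℤ.*-identityʳ _ ⟨
      qℤ * δ s * 1ℤ                                 ≡⟨ ℤ.+-identityˡ _ ⟨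
      1ℤ - 1ℤ + qℤ * δ s * 1ℤ                       ∎
    ... | no u≢0 = trans (∑-linear (u ⊗ u ⊝ s) (⊕-self-≢𝟘 u≢0)) (one (qℤ * δ s))
      where
      one : ∀ x → 1ℤ ≡ 1ℤ - 0ℤ + x * 0ℤ
      one = solve-∀
    -- Substituting a = u + b makes a² − b² − s linear in b.
    ∑-hyperbola : hyperbola ≡ qℤ - 1ℤ + qℤ * δ s
    ∑-hyperbola = begin
      ∑ Fₑ (λ a → ∑ Fₑ (λ b → δ (b ⊗ b ⊝ (a ⊗ a ⊝ s))))                   ≡⟨ ∑-swap Fₑ Fₑ ⟩
      ∑ Fₑ (λ b → ∑ Fₑ (λ a → δ (b ⊗ b ⊝ (a ⊗ a ⊝ s))))
        ≡⟨ ∑-cong Fₑ (λ b → ∑-shift b (λ a → δ (b ⊗ b ⊝ (a ⊗ a ⊝ s)))) ⟨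
      ∑ Fₑ (λ b → ∑ Fₑ (λ u → δ (b ⊗ b ⊝ ((u ⊕ b) ⊗ (u ⊕ b) ⊝ s))))
        ≡⟨ ∑-cong Fₑ (λ b → ∑-cong Fₑ (λ u → trans (cong δ (linearise s u b)) (δ-scale _ (⊖≢𝟘 𝟙≢𝟘)))) ⟩
      ∑ Fₑ (λ b → ∑ Fₑ (λ u → δ ((u ⊗ u ⊝ s) ⊕ b ⊗ (u ⊕ u))))             ≡⟨ ∑-swap Fₑ Fₑ ⟩
      ∑ Fₑ (λ u → ∑ Fₑ (λ b → δ ((u ⊗ u ⊝ s) ⊕ b ⊗ (u ⊕ u))))             ≡⟨ ∑-cong Fₑ slope ⟩
      ∑ Fₑ (λ u → 1ℤ - δ u + qℤ * δ s * δ u)                              ≡⟨ ∑-+ Fₑ ⟩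
      ∑ Fₑ (λ u → 1ℤ - δ u) + ∑ Fₑ (λ u → qℤ * δ s * δ u)
        ≡⟨ cong₂ _+_ (trans (∑-- Fₑ) (cong₂ _-_ ∑-one δ-sum)) (trans (∑-*ˡ Fₑ (qℤ * δ s)) (cong (qℤ * δ s *_) δ-sum)) ⟩
      qℤ - 1ℤ + qℤ * δ s * 1ℤ                                             ≡⟨ cong (qℤ - 1ℤ +_) (ℤ.*-identityʳ _) ⟩
      qℤ - 1ℤ + qℤ * δ s                                                  ∎
      where
      linearise : ∀ s u b → b ⊗ b ⊝ ((u ⊕ b) ⊗ (u ⊕ b) ⊝ s) ≡ ⊖ 𝟙 ⊗ ((u ⊗ u ⊝ s) ⊕ b ⊗ (u ⊕ u))
      linearise = solve 3 (λ s u b → b :* b :- ((u :+ b) :* (u :+ b) :- s) := (:- con 1ℤ) :* ((u :* u :- s) :+ b :* (u :+ u))) refl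
    lemma : ∀ q d → q * ℤ.+ 2 - (q - 1ℤ + q * d) ≡ q + 1ℤ - q * d
    lemma = solve-∀

-- Spheres, bisectors and pencils for the sum of squares.

module Distances {q : ℕ} (F : FieldOn (Fin q)) (q%4≡3 : q ℕ.% 4 ≡ 3) where
  open import Data.Integer.Base using (_+_; _*_; _-_; -_; _≤_)
  open FieldOn F
  open IntegerCoefficients commutativeRing
  open CommutativeRing commutativeRing
    using (+-identityˡ; +-identityʳ; zeroˡ; zeroʳ)
  open Counting F q%4≡3
  open Enumeration (Fin-enumeration q) using (_≟_) renaming (elements to Fₑ)

  V : ℕ → Set
  V n = Vec (Fin q) n

  Vₑ : ∀ n → List (V n)
  Vₑ n = Enumeration.elements (Vec-enumeration (Fin-enumeration q) n)

  infix 4 _≟ⱽ_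
  _≟ⱽ_ : ∀ {n} (x y : V n) → Dec (x ≡ y)
  _≟ⱽ_ {n} = Enumeration._≟_ (Vec-enumeration (Fin-enumeration q) n)

  ∑ⱽ-suc : ∀ n {f} → ∑ (Vₑ (suc n)) f ≡ ∑ Fₑ (λ a → ∑ (Vₑ n) (λ v → f (a ∷ v)))
  ∑ⱽ-suc n = ∑-vectors-suc (Fin-enumeration q) n

  ∑ⱽ-1 : ∀ n → ∑ (Vₑ n) (λ _ → 1ℤ) ≡ qℤ ℤ.^ n
  ∑ⱽ-1 zero    = refl
  ∑ⱽ-1 (suc n) = begin
    ∑ (Vₑ (suc n)) (λ _ → 1ℤ)              ≡⟨ ∑ⱽ-suc n ⟩
    ∑ Fₑ (λ _ → ∑ (Vₑ n) (λ _ → 1ℤ))       ≡⟨ ∑-constF _ ⟩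
    qℤ * ∑ (Vₑ n) (λ _ → 1ℤ)               ≡⟨ cong (qℤ *_) (∑ⱽ-1 n) ⟩
    qℤ * qℤ ℤ.^ n                          ∎
    where open ≡-Reasoning

  sq : Fin q → Fin q
  sq x = x ⊗ x

  dist : ∀ {n} → V n → V n → Fin q
  dist []       []       = 𝟘
  dist (x ∷ xs) (y ∷ ys) = sq (x ⊝ y) ⊕ dist xs ys

  dist-sym : ∀ {n} (x y : V n) → dist x y ≡ dist y x
  dist-sym []       []       = refl
  dist-sym (x ∷ xs) (y ∷ ys) = cong₂ _⊕_
    (solve 2 (λ x y → (x :- y) :* (x :- y) := (y :- x) :* (y :- x)) refl x y) (dist-sym xs ys)

  -- The sum of ψ(tx) over t ≠ 0, for any nontrivial additive character ψ: the part of q times the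
  -- indicator of zero that is orthogonal to constants.
  τ : Fin q → ℤ
  τ x = qℤ * δ x - 1ℤ

  τ-scale : ∀ {k} x → k ≢ 𝟘 → τ (k ⊗ x) ≡ τ x
  τ-scale x k≢0 = cong (λ d → qℤ * d - 1ℤ) (δ-scale x k≢0)

  -- By the point count of the conic, `τ` is an eigenfunction of summation over two squares. The
  -- eigenvalue -q is the squared Gauss sum, negative because -1 is a nonsquare.
  ∑-τ-two-squares : ∀ s → ∑ Fₑ (λ a → ∑ Fₑ (λ b → τ (s ⊕ sq a ⊕ sq b))) ≡ - qℤ * τ s
  ∑-τ-two-squares s = begin
    ∑ Fₑ (λ a → ∑ Fₑ (λ b → qℤ * δ (s ⊕ sq a ⊕ sq b) - 1ℤ))
      ≡⟨ ∑-cong Fₑ (λ a → trans (∑-- Fₑ) (cong₂ _-_ (∑-*ˡ Fₑ qℤ) ∑-one)) ⟩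
    ∑ Fₑ (λ a → qℤ * ∑ Fₑ (λ b → δ (s ⊕ sq a ⊕ sq b)) - qℤ)
      ≡⟨ trans (∑-- Fₑ) (cong₂ _-_ (∑-*ˡ Fₑ qℤ) (∑-constF qℤ)) ⟩
    qℤ * ∑ Fₑ (λ a → ∑ Fₑ (λ b → δ (s ⊕ sq a ⊕ sq b))) - qℤ * qℤ
      ≡⟨ cong (λ z → qℤ * z - qℤ * qℤ) (∑-cong Fₑ (λ a → ∑-cong Fₑ (λ b → cong δ (regroup s a b)))) ⟩
    qℤ * ∑ Fₑ (λ a → ∑ Fₑ (λ b → δ (sq b ⊝ (⊖ s ⊝ sq a)))) - qℤ * qℤ
      ≡⟨ cong (λ z → qℤ * z - qℤ * qℤ) (∑-sum-of-two-squares (⊖ s)) ⟩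
    qℤ * (qℤ + 1ℤ - qℤ * δ (⊖ s)) - qℤ * qℤ
      ≡⟨ cong (λ d → qℤ * (qℤ + 1ℤ - qℤ * d) - qℤ * qℤ) δ-⊖ ⟩
    qℤ * (qℤ + 1ℤ - qℤ * δ s) - qℤ * qℤ
      ≡⟨ lemma qℤ (δ s) ⟩
    - qℤ * (qℤ * δ s - 1ℤ)
      ∎
    where
    open ≡-Reasoning
    regroup : ∀ s a b → s ⊕ sq a ⊕ sq b ≡ sq b ⊝ (⊖ s ⊝ sq a)
    regroup = solve 3 (λ s a b → s :+ a :* a :+ b :* b := b :* b :- ((:- s) :- a :* a)) refl
    δ-⊖ : δ (⊖ s) ≡ δ s
    δ-⊖ = trans (cong δ (solve 1 (λ s → :- s := (:- con 1ℤ) :* s) refl s)) (δ-scale s (⊖≢𝟘 𝟙≢𝟘))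
    lemma : ∀ q d → q * (q + 1ℤ - q * d) - q * q ≡ - q * (q * d - 1ℤ)
    lemma = solve-∀

  -- Coordinates are removed in pairs, whence the dimension h · 2: after translation of the centre
  -- to the origin each pair contributes a factor -q to the error term.
  ∑-τ-sphere : ∀ h (x : V (h ℕ.* 2)) s →
    qℤ * ∑ (Vₑ (h ℕ.* 2)) (λ z → δ (s ⊕ dist z x)) ≡ qℤ ℤ.^ (h ℕ.* 2) + (- qℤ) ℤ.^ h * τ s
  ∑-τ-sphere zero [] s = begin
    qℤ * (δ (s ⊕ 𝟘) + 0ℤ)      ≡⟨ cong (λ z → qℤ * (δ z + 0ℤ)) (+-identityʳ s) ⟩
    qℤ * (δ s + 0ℤ)            ≡⟨ lemma qℤ (δ s) ⟩
    1ℤ + 1ℤ * (qℤ * δ s - 1ℤ)  ∎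
    where
    open ≡-Reasoning
    lemma : ∀ q d → q * (d + 0ℤ) ≡ 1ℤ + 1ℤ * (q * d - 1ℤ)
    lemma = solve-∀
  ∑-τ-sphere (suc h) (x ∷ y ∷ v) s = begin
    qℤ * ∑ (Vₑ (suc (suc n))) (λ z → δ (s ⊕ dist z (x ∷ y ∷ v)))
      ≡⟨ cong (qℤ *_) (trans (∑ⱽ-suc (suc n)) (∑-cong Fₑ (λ a → ∑ⱽ-suc n))) ⟩
    qℤ * ∑ Fₑ (λ a → ∑ Fₑ (λ b → ∑ (Vₑ n) (λ z → δ (s ⊕ (sq (a ⊝ x) ⊕ (sq (b ⊝ y) ⊕ dist z v))))))
      ≡⟨ cong (qℤ *_) (∑-shift (⊖ x) (λ a → ∑ Fₑ (λ b → ∑ (Vₑ n) (λ z → δ (s ⊕ (sq a ⊕ (sq (b ⊝ y) ⊕ dist z v))))))) ⟩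
    qℤ * ∑ Fₑ (λ a → ∑ Fₑ (λ b → ∑ (Vₑ n) (λ z → δ (s ⊕ (sq a ⊕ (sq (b ⊝ y) ⊕ dist z v))))))
      ≡⟨ cong (qℤ *_) (∑-cong Fₑ (λ a → ∑-shift (⊖ y) (λ b → ∑ (Vₑ n) (λ z → δ (s ⊕ (sq a ⊕ (sq b ⊕ dist z v))))))) ⟩
    qℤ * ∑ Fₑ (λ a → ∑ Fₑ (λ b → ∑ (Vₑ n) (λ z → δ (s ⊕ (sq a ⊕ (sq b ⊕ dist z v))))))
      ≡⟨ cong (qℤ *_) (∑-cong Fₑ (λ a → ∑-cong Fₑ (λ b → ∑-cong (Vₑ n) (λ z → cong δ (assoc s (sq a) (sq b) (dist z v)))))) ⟩
    qℤ * ∑ Fₑ (λ a → ∑ Fₑ (λ b → ∑ (Vₑ n) (λ z → δ (s ⊕ sq a ⊕ sq b ⊕ dist z v))))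
      ≡⟨ ∑-*ˡ Fₑ qℤ ⟨
    ∑ Fₑ (λ a → qℤ * ∑ Fₑ (λ b → ∑ (Vₑ n) (λ z → δ (s ⊕ sq a ⊕ sq b ⊕ dist z v))))
      ≡⟨ ∑-cong Fₑ (λ a → ∑-*ˡ Fₑ qℤ) ⟨
    ∑ Fₑ (λ a → ∑ Fₑ (λ b → qℤ * ∑ (Vₑ n) (λ z → δ (s ⊕ sq a ⊕ sq b ⊕ dist z v))))
      ≡⟨ ∑-cong Fₑ (λ a → ∑-cong Fₑ (λ b → ∑-τ-sphere h v (s ⊕ sq a ⊕ sq b))) ⟩
    ∑ Fₑ (λ a → ∑ Fₑ (λ b → qⁿ + ε * τ (s ⊕ sq a ⊕ sq b)))
      ≡⟨ ∑-cong Fₑ (λ a → trans (∑-+ Fₑ) (cong₂ _+_ (∑-constF qⁿ) (∑-*ˡ Fₑ ε))) ⟩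
    ∑ Fₑ (λ a → qℤ * qⁿ + ε * ∑ Fₑ (λ b → τ (s ⊕ sq a ⊕ sq b)))
      ≡⟨ trans (∑-+ Fₑ) (cong₂ _+_ (∑-constF (qℤ * qⁿ)) (∑-*ˡ Fₑ ε)) ⟩
    qℤ * (qℤ * qⁿ) + ε * ∑ Fₑ (λ a → ∑ Fₑ (λ b → τ (s ⊕ sq a ⊕ sq b)))
      ≡⟨ cong (λ z → qℤ * (qℤ * qⁿ) + ε * z) (∑-τ-two-squares s) ⟩
    qℤ * (qℤ * qⁿ) + ε * (- qℤ * τ s)
      ≡⟨ lemma (qℤ * (qℤ * qⁿ)) ε qℤ (τ s) ⟩
    qℤ * (qℤ * qⁿ) + - qℤ * ε * τ s
      ∎
    where
    open ≡-Reasoning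
    n = h ℕ.* 2
    qⁿ = qℤ ℤ.^ n
    ε = (- qℤ) ℤ.^ h
    assoc : ∀ s a b d → s ⊕ (a ⊕ (b ⊕ d)) ≡ s ⊕ a ⊕ b ⊕ d
    assoc = solve 4 (λ s a b d → s :+ (a :+ (b :+ d)) := s :+ a :+ b :+ d) refl
    lemma : ∀ p e q t → p + e * (- q * t) ≡ p + - q * e * t
    lemma = solve-∀

  -- At the first coordinate where `x` and `y` differ, the equation is linear and nonconstant in
  -- that coordinate of z, so the remaining ones are free. Equal coordinates cancel; if all are
  -- equal, only s = 0 is left to decide, and `τ s` corrects the count.
  ∑-bisector : ∀ n (x y : V n) s →
    qℤ * ∑ (Vₑ n) (λ z → δ (s ⊕ (dist z x ⊝ dist z y))) ≡ qℤ ℤ.^ n + qℤ ℤ.^ n * τ s * [ x ≟ⱽ y ]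
  ∑-bisector zero [] [] s = begin
    qℤ * (δ (s ⊕ (𝟘 ⊝ 𝟘)) + 0ℤ)     ≡⟨ cong (λ z → qℤ * (δ z + 0ℤ)) (solve 1 (λ s → s :+ (con 0ℤ :- con 0ℤ) := s) refl s) ⟩
    qℤ * (δ s + 0ℤ)                 ≡⟨ lemma qℤ (δ s) ⟩
    1ℤ + 1ℤ * τ s * 1ℤ              ∎
    where
    open ≡-Reasoning
    lemma : ∀ q d → q * (d + 0ℤ) ≡ 1ℤ + 1ℤ * (q * d - 1ℤ) * 1ℤ
    lemma = solve-∀
  ∑-bisector (suc n) (x ∷ v) (y ∷ w) s = trans (cong (qℤ *_) (∑ⱽ-suc n)) (step (x ≟ y))
    where
    open ≡-Reasoning
    qⁿ = qℤ ℤ.^ n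
    step : Dec (x ≡ y) →
      qℤ * ∑ Fₑ (λ a → ∑ (Vₑ n) (λ z → δ (s ⊕ (sq (a ⊝ x) ⊕ dist z v ⊝ (sq (a ⊝ y) ⊕ dist z w))))) ≡
      qℤ * qⁿ + qℤ * qⁿ * τ s * [ x ∷ v ≟ⱽ y ∷ w ]
    step (yes refl) = begin
      qℤ * ∑ Fₑ (λ a → ∑ (Vₑ n) (λ z → δ (s ⊕ (sq (a ⊝ x) ⊕ dist z v ⊝ (sq (a ⊝ x) ⊕ dist z w)))))
        ≡⟨ cong (qℤ *_) (∑-cong Fₑ (λ a → ∑-cong (Vₑ n) (λ z → cong δ (cancel s (sq (a ⊝ x)) (dist z v) (dist z w))))) ⟩
      qℤ * ∑ Fₑ (λ a → ∑ (Vₑ n) (λ z → δ (s ⊕ (dist z v ⊝ dist z w))))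
        ≡⟨ cong (qℤ *_) (∑-constF _) ⟩
      qℤ * (qℤ * ∑ (Vₑ n) (λ z → δ (s ⊕ (dist z v ⊝ dist z w))))
        ≡⟨ cong (qℤ *_) (∑-bisector n v w s) ⟩
      qℤ * (qⁿ + qⁿ * τ s * [ v ≟ⱽ w ])
        ≡⟨ cong (λ e → qℤ * (qⁿ + qⁿ * τ s * e)) ([]-cong (v ≟ⱽ w) (x ∷ v ≟ⱽ x ∷ w) (cong (x ∷_)) Vec.∷-injectiveʳ) ⟩
      qℤ * (qⁿ + qⁿ * τ s * [ x ∷ v ≟ⱽ x ∷ w ])
        ≡⟨ lemma qℤ qⁿ (τ s) _ ⟩
      qℤ * qⁿ + qℤ * qⁿ * τ s * [ x ∷ v ≟ⱽ x ∷ w ]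
        ∎
      where
      cancel : ∀ s a d e → s ⊕ (a ⊕ d ⊝ (a ⊕ e)) ≡ s ⊕ (d ⊝ e)
      cancel = solve 4 (λ s a d e → s :+ (a :+ d :- (a :+ e)) := s :+ (d :- e)) refl
      lemma : ∀ q p t e → q * (p + p * t * e) ≡ q * p + q * p * t * e
      lemma = solve-∀
    step (no x≢y) = begin
      qℤ * ∑ Fₑ (λ a → ∑ (Vₑ n) (λ z → δ (s ⊕ (sq (a ⊝ x) ⊕ dist z v ⊝ (sq (a ⊝ y) ⊕ dist z w)))))
        ≡⟨ cong (qℤ *_) (∑-swap Fₑ (Vₑ n)) ⟩
      qℤ * ∑ (Vₑ n) (λ z → ∑ Fₑ (λ a → δ (s ⊕ (sq (a ⊝ x) ⊕ dist z v ⊝ (sq (a ⊝ y) ⊕ dist z w)))))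
        ≡⟨ cong (qℤ *_) (∑-cong (Vₑ n) (λ z → trans (∑-cong Fₑ (λ a → cong δ (linearise s a (dist z v) (dist z w) x y)))
             (∑-linear (s ⊕ (sq x ⊝ sq y) ⊕ (dist z v ⊝ dist z w)) (⊕-self-≢𝟘 (⊝-≢𝟘 (x≢y ∘ sym)))))) ⟩
      qℤ * ∑ (Vₑ n) (λ z → 1ℤ)
        ≡⟨ cong (qℤ *_) (∑ⱽ-1 n) ⟩
      qℤ * qⁿ
        ≡⟨ lemma (qℤ * qⁿ) (τ s) ⟩
      qℤ * qⁿ + qℤ * qⁿ * τ s * 0ℤ
        ≡⟨ cong (λ e → qℤ * qⁿ + qℤ * qⁿ * τ s * e) ([]-false (x ∷ v ≟ⱽ y ∷ w) (x≢y ∘ Vec.∷-injectiveˡ)) ⟨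
      qℤ * qⁿ + qℤ * qⁿ * τ s * [ x ∷ v ≟ⱽ y ∷ w ]
        ∎
      where
      linearise : ∀ s a d e x y →
        s ⊕ (sq (a ⊝ x) ⊕ d ⊝ (sq (a ⊝ y) ⊕ e)) ≡ s ⊕ (sq x ⊝ sq y) ⊕ (d ⊝ e) ⊕ a ⊗ ((y ⊝ x) ⊕ (y ⊝ x))
      linearise = solve 6 (λ s a d e x y →
        s :+ ((a :- x) :* (a :- x) :+ d :- ((a :- y) :* (a :- y) :+ e)) :=
        s :+ (x :* x :- y :* y) :+ (d :- e) :+ a :* ((y :- x) :+ (y :- x))) refl
      lemma : ∀ p t → p ≡ p + p * t * 0ℤ
      lemma = solve-∀

  -- Of the q + 1 members A + cB, B of the pencil, exactly one vanishes unless
  -- A = B = 0, when all do.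
  pencil : ∀ A B → qℤ * (δ A * δ B) ≡ δ B + ∑ Fₑ (λ c → δ (A ⊕ c ⊗ B)) - 1ℤ
  pencil A B with B ≟ 𝟘
  ... | yes refl = begin
    qℤ * (δ A * 1ℤ)                              ≡⟨ lemma qℤ (δ A) ⟩
    1ℤ + qℤ * δ A - 1ℤ                           ≡⟨ cong (λ z → 1ℤ + z - 1ℤ) (∑-constF (δ A)) ⟨
    1ℤ + ∑ Fₑ (λ _ → δ A) - 1ℤ
      ≡⟨ cong (λ z → 1ℤ + z - 1ℤ) (∑-cong Fₑ (λ c → cong δ (solve 2 (λ a c → a := a :+ c :* con 0ℤ) refl A c))) ⟩
    1ℤ + ∑ Fₑ (λ c → δ (A ⊕ c ⊗ 𝟘)) - 1ℤ         ∎
    where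
    open ≡-Reasoning
    lemma : ∀ q a → q * (a * 1ℤ) ≡ 1ℤ + q * a - 1ℤ
    lemma = solve-∀
  ... | no B≢0 = begin
    qℤ * (δ A * 0ℤ)                              ≡⟨ lemma qℤ (δ A) ⟩
    0ℤ + 1ℤ - 1ℤ                                 ≡⟨ cong (λ z → 0ℤ + z - 1ℤ) (∑-linear A B≢0) ⟨
    0ℤ + ∑ Fₑ (λ c → δ (A ⊕ c ⊗ B)) - 1ℤ         ∎
    where
    open ≡-Reasoning
    lemma : ∀ q a → q * (a * 0ℤ) ≡ 0ℤ + 1ℤ - 1ℤ
    lemma = solve-∀

  -- With `u` the inverse of 1 + c, this is the centre of the sphere given by the pencil member with
  -- parameter c.
  barycentre : ∀ {n} (u c : Fin q) → V n → V n → V n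
  barycentre u c = Vec.zipWith (λ a b → u ⊗ (a ⊕ c ⊗ b))

  -- Stewart's identity for the weights 1 and c. It is additive over coordinates, so the scalar case
  -- suffices.
  complete-square : ∀ {n} c u → u ⊗ (𝟙 ⊕ c) ≡ 𝟙 → (z x y : V n) →
    dist z x ⊕ c ⊗ dist z y ≡ (𝟙 ⊕ c) ⊗ (u ⊗ u ⊗ (c ⊗ dist x y) ⊕ dist z (barycentre u c x y))
  complete-square c u uk≡1 [] [] [] =
    solve 2 (λ c u → con 0ℤ :+ c :* con 0ℤ := (con 1ℤ :+ c) :* (u :* u :* (c :* con 0ℤ) :+ con 0ℤ)) refl c u
  complete-square c u uk≡1 (z ∷ zs) (x ∷ xs) (y ∷ ys) = begin
    sq (z ⊝ x) ⊕ dist zs xs ⊕ c ⊗ (sq (z ⊝ y) ⊕ dist zs ys)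
      ≡⟨ solve 5 (λ a b c d e → a :+ b :+ c :* (d :+ e) := a :+ c :* d :+ (b :+ c :* e)) refl (sq (z ⊝ x)) (dist zs xs) c (sq (z ⊝ y)) (dist zs ys) ⟩
    (sq (z ⊝ x) ⊕ c ⊗ sq (z ⊝ y)) ⊕ (dist zs xs ⊕ c ⊗ dist zs ys)
      ≡⟨ cong₂ _⊕_ (scalar z x y) (complete-square c u uk≡1 zs xs ys) ⟩
    (𝟙 ⊕ c) ⊗ (u ⊗ u ⊗ (c ⊗ sq (x ⊝ y)) ⊕ sq (z ⊝ u ⊗ (x ⊕ c ⊗ y))) ⊕ (𝟙 ⊕ c) ⊗ (u ⊗ u ⊗ (c ⊗ dist xs ys) ⊕ dist zs (barycentre u c xs ys))
      ≡⟨ solve 6 (λ c u d e f g → (con 1ℤ :+ c) :* (u :* u :* (c :* d) :+ e) :+ (con 1ℤ :+ c) :* (u :* u :* (c :* f) :+ g) :=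
           (con 1ℤ :+ c) :* (u :* u :* (c :* (d :+ f)) :+ (e :+ g))) refl c u (sq (x ⊝ y)) (sq (z ⊝ u ⊗ (x ⊕ c ⊗ y))) (dist xs ys) (dist zs (barycentre u c xs ys)) ⟩
    (𝟙 ⊕ c) ⊗ (u ⊗ u ⊗ (c ⊗ (sq (x ⊝ y) ⊕ dist xs ys)) ⊕ (sq (z ⊝ u ⊗ (x ⊕ c ⊗ y)) ⊕ dist zs (barycentre u c xs ys)))
      ∎
    where
    open ≡-Reasoning
    -- The two sides differ by a multiple of u(1 + c) − 1.
    error : ∀ z x y → Fin q
    error z x y = (u ⊗ (𝟙 ⊕ c) ⊕ 𝟙) ⊗ (sq x ⊕ c ⊗ sq y) ⊝ (z ⊕ z) ⊗ (x ⊕ c ⊗ y)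
    scalar : ∀ z x y → sq (z ⊝ x) ⊕ c ⊗ sq (z ⊝ y) ≡ (𝟙 ⊕ c) ⊗ (u ⊗ u ⊗ (c ⊗ sq (x ⊝ y)) ⊕ sq (z ⊝ u ⊗ (x ⊕ c ⊗ y)))
    scalar z x y = sym (begin
      (𝟙 ⊕ c) ⊗ (u ⊗ u ⊗ (c ⊗ sq (x ⊝ y)) ⊕ sq (z ⊝ u ⊗ (x ⊕ c ⊗ y)))
        ≡⟨ solve 5 (λ c u z x y → let k = con 1ℤ :+ c ; m = z :- u :* (x :+ c :* y) in
             k :* (u :* u :* (c :* ((x :- y) :* (x :- y))) :+ m :* m) :=
             (z :- x) :* (z :- x) :+ c :* ((z :- y) :* (z :- y)) :+
             (u :* k :- con 1ℤ) :* ((u :* k :+ con 1ℤ) :* (x :* x :+ c :* (y :* y)) :- (z :+ z) :* (x :+ c :* y))) refl c u z x y ⟩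
      sq (z ⊝ x) ⊕ c ⊗ sq (z ⊝ y) ⊕ (u ⊗ (𝟙 ⊕ c) ⊝ 𝟙) ⊗ error z x y
        ≡⟨ cong (λ e → sq (z ⊝ x) ⊕ c ⊗ sq (z ⊝ y) ⊕ (e ⊝ 𝟙) ⊗ error z x y) uk≡1 ⟩
      sq (z ⊝ x) ⊕ c ⊗ sq (z ⊝ y) ⊕ (𝟙 ⊝ 𝟙) ⊗ error z x y
        ≡⟨ solve 2 (λ a e → a :+ (con 1ℤ :- con 1ℤ) :* e := a) refl (sq (z ⊝ x) ⊕ c ⊗ sq (z ⊝ y)) (error z x y) ⟩
      sq (z ⊝ x) ⊕ c ⊗ sq (z ⊝ y)
        ∎)

  -- The right-hand side separates c = 0 from the q - 1 nonzero multiples, all of which have the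
  -- same `τ` as `D`; the proof counts the zeros of `c ⊗ D`.
  ∑-τ-multiples : ∀ D → ∑ Fₑ (λ c → τ (c ⊗ D)) ≡ τ 𝟘 + (qℤ - 1ℤ) * τ D
  ∑-τ-multiples D = begin
    ∑ Fₑ (λ c → qℤ * δ (c ⊗ D) - 1ℤ)          ≡⟨ trans (∑-- Fₑ) (cong₂ _-_ (∑-*ˡ Fₑ qℤ) ∑-one) ⟩
    qℤ * ∑ Fₑ (λ c → δ (c ⊗ D)) - qℤ          ≡⟨ cong (λ z → qℤ * z - qℤ) zeros ⟩
    qℤ * (1ℤ + (qℤ - 1ℤ) * δ D) - qℤ          ≡⟨ lemma qℤ (δ D) ⟩
    qℤ * 1ℤ - 1ℤ + (qℤ - 1ℤ) * τ D            ≡⟨ cong (λ d → qℤ * d - 1ℤ + (qℤ - 1ℤ) * τ D) δ-𝟘 ⟨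
    τ 𝟘 + (qℤ - 1ℤ) * τ D                     ∎
    where
    open ≡-Reasoning
    zeros : ∑ Fₑ (λ c → δ (c ⊗ D)) ≡ 1ℤ + (qℤ - 1ℤ) * δ D
    zeros with D ≟ 𝟘
    ... | yes refl = trans (∑-cong Fₑ (λ c → trans (cong δ (zeroʳ c)) δ-𝟘)) (trans ∑-one (lemma₁ qℤ))
      where
      lemma₁ : ∀ q → q ≡ 1ℤ + (q - 1ℤ) * 1ℤ
      lemma₁ = solve-∀
    ... | no D≢0 = trans (∑-cong Fₑ (λ c → cong δ (sym (+-identityˡ (c ⊗ D)))))
                     (trans (∑-linear 𝟘 D≢0) (cong (1ℤ +_) (sym (ℤ.*-zeroʳ (qℤ - 1ℤ)))))
    lemma : ∀ q d → q * (1ℤ + (q - 1ℤ) * d) - q ≡ q * 1ℤ - 1ℤ + (q - 1ℤ) * (q * d - 1ℤ)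
    lemma = solve-∀

  -- The entries of T².

  module _ (h : ℕ) where
    private
      n = h ℕ.* 2
      qⁿ = qℤ ℤ.^ n
      ε = (- qℤ) ℤ.^ h

    -- In even dimension a sphere count sees only whether the radius vanishes, so the factor u² from
    -- completing the square disappears. The term with `δ (𝟙 ⊕ c)` exchanges the spherical value for
    -- the hyperplane's at c = -1, leaving one formula to be summed over c.
    ∑-pencil-member : ∀ (x y : V n) c → qℤ * ∑ (Vₑ n) (λ z → δ (dist z x ⊕ c ⊗ dist z y)) ≡
      qⁿ + ε * τ (c ⊗ dist x y) + δ (𝟙 ⊕ c) * (qⁿ * (qℤ - 1ℤ) * [ x ≟ⱽ y ] - ε * τ (dist x y))
    ∑-pencil-member x y c with 𝟙 ⊕ c ≟ 𝟘
    ... | yes 1+c≡0 = begin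
      qℤ * ∑ (Vₑ n) (λ z → δ (dist z x ⊕ c ⊗ dist z y))
        ≡⟨ cong (qℤ *_) (∑-cong (Vₑ n) (λ z → cong δ (trans (cong (λ c → dist z x ⊕ c ⊗ dist z y) c≡-1)
             (solve 2 (λ a b → a :+ (:- con 1ℤ) :* b := con 0ℤ :+ (a :- b)) refl (dist z x) (dist z y))))) ⟩
      qℤ * ∑ (Vₑ n) (λ z → δ (𝟘 ⊕ (dist z x ⊝ dist z y)))
        ≡⟨ ∑-bisector n x y 𝟘 ⟩
      qⁿ + qⁿ * τ 𝟘 * [ x ≟ⱽ y ]
        ≡⟨ cong (λ d → qⁿ + qⁿ * (qℤ * d - 1ℤ) * [ x ≟ⱽ y ]) δ-𝟘 ⟩
      qⁿ + qⁿ * (qℤ * 1ℤ - 1ℤ) * [ x ≟ⱽ y ]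
        ≡⟨ lemma qⁿ qℤ _ (ε * τ (dist x y)) ⟩
      qⁿ + ε * τ (dist x y) + 1ℤ * (qⁿ * (qℤ - 1ℤ) * [ x ≟ⱽ y ] - ε * τ (dist x y))
        ≡⟨ cong (λ t → qⁿ + ε * t + 1ℤ * (qⁿ * (qℤ - 1ℤ) * [ x ≟ⱽ y ] - ε * τ (dist x y)))
             (trans (cong (λ c → τ (c ⊗ dist x y)) c≡-1) (τ-scale (dist x y) (⊖≢𝟘 𝟙≢𝟘))) ⟨
      qⁿ + ε * τ (c ⊗ dist x y) + 1ℤ * (qⁿ * (qℤ - 1ℤ) * [ x ≟ⱽ y ] - ε * τ (dist x y))
        ∎
      where
      open ≡-Reasoning
      c≡-1 : c ≡ ⊖ 𝟙
      c≡-1 = ⊝≡𝟘⇒≡ (trans (solve 1 (λ c → c :- (:- con 1ℤ) := con 1ℤ :+ c) refl c) 1+c≡0)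
      lemma : ∀ p q e t → p + p * (q * 1ℤ - 1ℤ) * e ≡ p + t + 1ℤ * (p * (q - 1ℤ) * e - t)
      lemma = solve-∀
    ... | no 1+c≢0 with (u , uk≡1) ← invertible 1+c≢0 = begin
      qℤ * ∑ (Vₑ n) (λ z → δ (dist z x ⊕ c ⊗ dist z y))
        ≡⟨ cong (qℤ *_) (∑-cong (Vₑ n) (λ z → trans (cong δ (complete-square c u uk≡1 z x y)) (δ-scale _ 1+c≢0))) ⟩
      qℤ * ∑ (Vₑ n) (λ z → δ (u ⊗ u ⊗ (c ⊗ dist x y) ⊕ dist z (barycentre u c x y)))
        ≡⟨ ∑-τ-sphere h (barycentre u c x y) _ ⟩
      qⁿ + ε * τ (u ⊗ u ⊗ (c ⊗ dist x y))
        ≡⟨ cong (λ t → qⁿ + ε * t) (τ-scale (c ⊗ dist x y) (⊗-≢𝟘 u≢0 u≢0)) ⟩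
      qⁿ + ε * τ (c ⊗ dist x y)
        ≡⟨ ℤ.+-identityʳ _ ⟨
      qⁿ + ε * τ (c ⊗ dist x y) + 0ℤ
        ∎
      where
      open ≡-Reasoning
      u≢0 : u ≢ 𝟘
      u≢0 refl = 𝟙≢𝟘 (trans (sym uk≡1) (zeroˡ (𝟙 ⊕ c)))

    -- The factor q - 2 counts the c other than 0 and -1: the member c = 0 cancels against the
    -- linear term in `dist z x`, and c = -1 is the hyperplane, which supplies the diagonal term.
    ∑-τ-τ : ∀ (x y : V n) → ∑ (Vₑ n) (λ z → τ (dist z x) * τ (dist z y)) ≡
      qⁿ * (qℤ - 1ℤ) * [ x ≟ⱽ y ] + ε * ((qℤ - ℤ.+ 2) * τ (dist x y))
    ∑-τ-τ x y = begin
      ∑ (Vₑ n) (λ z → τ (dist z x) * τ (dist z y))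
        ≡⟨ ∑-cong (Vₑ n) pointwise ⟩
      ∑ (Vₑ n) (λ z → qℤ * ∑ Fₑ (λ c → δ (dist z x ⊕ c ⊗ dist z y)) - qℤ * δ (𝟘 ⊕ dist z x) + (1ℤ - qℤ) * 1ℤ)
        ≡⟨ trans (∑-+ (Vₑ n)) (cong₂ _+_ (trans (∑-- (Vₑ n)) (cong₂ _-_ (∑-*ˡ (Vₑ n) qℤ) (∑-*ˡ (Vₑ n) qℤ))) (∑-*ˡ (Vₑ n) (1ℤ - qℤ))) ⟩
      qℤ * ∑ (Vₑ n) (λ z → ∑ Fₑ (λ c → δ (dist z x ⊕ c ⊗ dist z y))) - qℤ * ∑ (Vₑ n) (λ z → δ (𝟘 ⊕ dist z x)) + (1ℤ - qℤ) * ∑ (Vₑ n) (λ _ → 1ℤ)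
        ≡⟨ cong₂ _+_ (cong₂ _-_ pencils (∑-τ-sphere h x 𝟘)) (cong ((1ℤ - qℤ) *_) (∑ⱽ-1 n)) ⟩
      qℤ * qⁿ + ε * (τ 𝟘 + (qℤ - 1ℤ) * τ D) + 1ℤ * (qⁿ * (qℤ - 1ℤ) * [ x ≟ⱽ y ] - ε * τ D) - (qⁿ + ε * τ 𝟘) + (1ℤ - qℤ) * qⁿ
        ≡⟨ lemma qℤ qⁿ ε (τ 𝟘) (τ D) _ ⟩
      qⁿ * (qℤ - 1ℤ) * [ x ≟ⱽ y ] + ε * ((qℤ - ℤ.+ 2) * τ D)
        ∎
      where
      open ≡-Reasoning
      D = dist x y
      expand : ∀ q a b s → q * (a * b) ≡ b + s - 1ℤ → (q * a - 1ℤ) * (q * b - 1ℤ) ≡ q * s - q * a + (1ℤ - q) * 1ℤ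
      expand q a b s eq = begin
        (q * a - 1ℤ) * (q * b - 1ℤ)                    ≡⟨ lemma₁ q a b ⟩
        q * (q * (a * b)) - q * a - q * b + 1ℤ         ≡⟨ cong (λ z → q * z - q * a - q * b + 1ℤ) eq ⟩
        q * (b + s - 1ℤ) - q * a - q * b + 1ℤ          ≡⟨ lemma₂ q a b s ⟩
        q * s - q * a + (1ℤ - q) * 1ℤ                  ∎
        where
        lemma₁ : ∀ q a b → (q * a - 1ℤ) * (q * b - 1ℤ) ≡ q * (q * (a * b)) - q * a - q * b + 1ℤ
        lemma₁ = solve-∀
        lemma₂ : ∀ q a b s → q * (b + s - 1ℤ) - q * a - q * b + 1ℤ ≡ q * s - q * a + (1ℤ - q) * 1ℤ
        lemma₂ = solve-∀
      pointwise : ∀ z → τ (dist z x) * τ (dist z y) ≡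
        qℤ * ∑ Fₑ (λ c → δ (dist z x ⊕ c ⊗ dist z y)) - qℤ * δ (𝟘 ⊕ dist z x) + (1ℤ - qℤ) * 1ℤ
      pointwise z = trans (expand qℤ (δ (dist z x)) (δ (dist z y)) _ (pencil (dist z x) (dist z y)))
        (cong (λ d → qℤ * ∑ Fₑ (λ c → δ (dist z x ⊕ c ⊗ dist z y)) - qℤ * δ d + (1ℤ - qℤ) * 1ℤ) (sym (+-identityˡ (dist z x))))
      K = qⁿ * (qℤ - 1ℤ) * [ x ≟ⱽ y ] - ε * τ D
      pencils : qℤ * ∑ (Vₑ n) (λ z → ∑ Fₑ (λ c → δ (dist z x ⊕ c ⊗ dist z y))) ≡
                qℤ * qⁿ + ε * (τ 𝟘 + (qℤ - 1ℤ) * τ D) + 1ℤ * K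
      pencils = begin
        qℤ * ∑ (Vₑ n) (λ z → ∑ Fₑ (λ c → δ (dist z x ⊕ c ⊗ dist z y)))
          ≡⟨ trans (cong (qℤ *_) (∑-swap (Vₑ n) Fₑ)) (sym (∑-*ˡ Fₑ qℤ)) ⟩
        ∑ Fₑ (λ c → qℤ * ∑ (Vₑ n) (λ z → δ (dist z x ⊕ c ⊗ dist z y)))
          ≡⟨ ∑-cong Fₑ (∑-pencil-member x y) ⟩
        ∑ Fₑ (λ c → qⁿ + ε * τ (c ⊗ D) + δ (𝟙 ⊕ c) * K)
          ≡⟨ trans (∑-+ Fₑ) (cong₂ _+_ (∑-+ Fₑ) (∑-*ʳ Fₑ K)) ⟩
        ∑ Fₑ (λ c → qⁿ) + ∑ Fₑ (λ c → ε * τ (c ⊗ D)) + ∑ Fₑ (λ c → δ (𝟙 ⊕ c)) * K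
          ≡⟨ cong₂ _+_ (cong₂ _+_ (∑-constF qⁿ) (trans (∑-*ˡ Fₑ ε) (cong (ε *_) (∑-τ-multiples D))))
               (cong (_* K) (trans (∑-cong Fₑ (λ c → cong δ (solve 1 (λ c → con 1ℤ :+ c := c :- (:- con 1ℤ)) refl c))) (∑-⊝ (⊖ 𝟙)))) ⟩
        qℤ * qⁿ + ε * (τ 𝟘 + (qℤ - 1ℤ) * τ D) + 1ℤ * K
          ∎
      lemma : ∀ q p e t₀ t i →
        q * p + e * (t₀ + (q - 1ℤ) * t) + 1ℤ * (p * (q - 1ℤ) * i - e * t) - (p + e * t₀) + (1ℤ - q) * p ≡
        p * (q - 1ℤ) * i + e * ((q - ℤ.+ 2) * t)
      lemma = solve-∀

  -- For odd h the matrix R is positive semidefinite, being a positive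
  -- multiple of a projection.
  module _ (k : ℕ) where
    private
      h = suc (k ℕ.* 2)
      n = h ℕ.* 2
      κ = qℤ ℤ.^ h

    R : V n → V n → ℤ
    R z x = κ * [ z ≟ⱽ x ] - τ (dist z x)

    -- With R = κ - T and (-q)ʰ = -κ, the coefficients of T in -2κT and in T² add up to -2κ - (q -
    -- 2)κ = -qκ, and those of the identity to κ² + (q - 1)κ² = qκ².
    ∑-R-R : ∀ x y → ∑ (Vₑ n) (λ z → R z x * R z y) ≡ qℤ * κ * R x y
    ∑-R-R x y = begin
      ∑ (Vₑ n) (λ z → R z x * R z y)
        ≡⟨ ∑-cong (Vₑ n) (λ z → expand κ [ z ≟ⱽ x ] [ z ≟ⱽ y ] (τ (dist z x)) (τ (dist z y))) ⟩
      ∑ (Vₑ n) (λ z → [ z ≟ⱽ x ] * (κ * R z y) - [ z ≟ⱽ y ] * (κ * τ (dist z x)) + τ (dist z x) * τ (dist z y))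
        ≡⟨ trans (∑-+ (Vₑ n)) (cong₂ _+_ (trans (∑-- (Vₑ n)) (cong₂ _-_ (sift x (λ z → κ * R z y)) (sift y (λ z → κ * τ (dist z x))))) (∑-τ-τ h x y)) ⟩
      κ * R x y - κ * τ (dist y x) + (qℤ ℤ.^ n * (qℤ - 1ℤ) * [ x ≟ⱽ y ] + (- qℤ) ℤ.^ h * ((qℤ - ℤ.+ 2) * τ (dist x y)))
        ≡⟨ cong₂ (λ D e → κ * R x y - κ * τ D + e) (dist-sym y x)
             (cong₂ (λ p e → p * (qℤ - 1ℤ) * [ x ≟ⱽ y ] + e * ((qℤ - ℤ.+ 2) * τ (dist x y))) (square qℤ h) (odd-power k)) ⟩
      κ * R x y - κ * τ (dist x y) + (κ * κ * (qℤ - 1ℤ) * [ x ≟ⱽ y ] + - κ * ((qℤ - ℤ.+ 2) * τ (dist x y)))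
        ≡⟨ lemma κ qℤ [ x ≟ⱽ y ] (τ (dist x y)) ⟩
      qℤ * κ * R x y
        ∎
      where
      open ≡-Reasoning
      sift = Enumeration.∑-sift (Vec-enumeration (Fin-enumeration q) n)
      square : ∀ i m → i ℤ.^ (m ℕ.* 2) ≡ i ℤ.^ m * i ℤ.^ m
      square i m = trans (sym (ℤ.^-*-assoc i m 2)) (cong (i ℤ.^ m *_) (ℤ.*-identityʳ (i ℤ.^ m)))
      odd-power : ∀ m → (- qℤ) ℤ.^ suc (m ℕ.* 2) ≡ - (qℤ ℤ.^ suc (m ℕ.* 2))
      odd-power m = begin
        - qℤ * (- qℤ) ℤ.^ (m ℕ.* 2)                ≡⟨ cong (- qℤ *_) (even m) ⟩
        - qℤ * qℤ ℤ.^ (m ℕ.* 2)                    ≡⟨ ℤ.neg-distribˡ-* qℤ _ ⟨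
        - (qℤ * qℤ ℤ.^ (m ℕ.* 2))                  ∎
        where
        lemma₀ : ∀ q p → - q * (- q * p) ≡ q * (q * p)
        lemma₀ = solve-∀
        even : ∀ m → (- qℤ) ℤ.^ (m ℕ.* 2) ≡ qℤ ℤ.^ (m ℕ.* 2)
        even zero    = refl
        even (suc m) = trans (cong (λ p → - qℤ * (- qℤ * p)) (even m)) (lemma₀ qℤ _)
      expand : ∀ κ i j s t → (κ * i - s) * (κ * j - t) ≡ i * (κ * (κ * j - t)) - j * (κ * s) + s * t
      expand = solve-∀
      lemma : ∀ κ q i t → κ * (κ * i - t) - κ * t + (κ * κ * (q - 1ℤ) * i + - κ * ((q - ℤ.+ 2) * t)) ≡ q * κ * (κ * i - t)
      lemma = solve-∀

    -- Since R² = qκR, the form multiplied by qκ > 0 is a sum over z of squares of row sums.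
    0≤∑∑R : ∀ (xs : List (V n)) → 0ℤ ≤ ∑ xs (λ x → ∑ xs (R x))
    0≤∑∑R xs = ℤ.*-cancelˡ-≤-pos 0ℤ _ (qℤ * κ) (begin
      qℤ * κ * 0ℤ                                            ≡⟨ ℤ.*-zeroʳ (qℤ * κ) ⟩
      0ℤ                                                     ≤⟨ 0≤∑ (Vₑ n) (λ z → 0≤i*i (∑ xs (R z))) ⟩
      ∑ (Vₑ n) (λ z → ∑ xs (R z) * ∑ xs (R z))               ≡⟨ ∑-cong (Vₑ n) (λ z → ∑-product xs xs) ⟩
      ∑ (Vₑ n) (λ z → ∑ xs (λ x → ∑ xs (λ y → R z x * R z y))) ≡⟨ ∑-swap (Vₑ n) xs ⟩
      ∑ xs (λ x → ∑ (Vₑ n) (λ z → ∑ xs (λ y → R z x * R z y))) ≡⟨ ∑-cong xs (λ x → ∑-swap (Vₑ n) xs) ⟩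
      ∑ xs (λ x → ∑ xs (λ y → ∑ (Vₑ n) (λ z → R z x * R z y))) ≡⟨ ∑-cong xs (λ x → ∑-cong xs (∑-R-R x)) ⟩
      ∑ xs (λ x → ∑ xs (λ y → qℤ * κ * R x y))               ≡⟨ ∑-cong xs (λ x → ∑-*ˡ xs (qℤ * κ)) ⟩
      ∑ xs (λ x → qℤ * κ * ∑ xs (R x))                       ≡⟨ ∑-*ˡ xs (qℤ * κ) ⟩
      qℤ * κ * ∑ xs (λ x → ∑ xs (R x))                       ∎)
      where
      open ℤ.≤-Reasoning
      instance
        q≢0 : ℕ.NonZero q
        q≢0 = ℕ.≢-nonZero (λ { refl → case q%4≡3 of λ () })
        pos : ℤ.Positive (qℤ * κ)
        pos = subst ℤ.Positive (pos-^ q (suc h)) (ℤ.positive (ℤ.+<+ (ℕ.n≢0⇒n>0 (ℕ.≢-nonZero⁻¹ _ {{ℕ.m^n≢0 q (suc h)}}))))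

    -- Positivity of the form reads qM ≤ l² + κE, where l² comes from the constant -1 in `τ`; the
    -- absence of duplicates bounds the diagonal count E by l.
    ∑-δ-dist≤ : ∀ {xs : List (V n)} → Propositional.Unique xs →
      qℤ * ∑ xs (λ x → ∑ xs (λ y → δ (dist x y))) ≤ ℤ.+ length xs * ℤ.+ length xs + κ * ℤ.+ length xs
    ∑-δ-dist≤ {xs} xs! = begin
      qℤ * M                            ≤⟨ ℤ.0≤i-j⇒j≤i (subst (0ℤ ≤_) ∑∑R (0≤∑∑R xs)) ⟩
      l * l + κ * E                     ≤⟨ ℤ.+-monoʳ-≤ (l * l) (ℤ.*-monoˡ-≤-nonNeg κ diagonal) ⟩
      l * l + κ * l                     ∎
      where
      open ℤ.≤-Reasoning
      l = ℤ.+ length xs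
      M = ∑ xs (λ x → ∑ xs (λ y → δ (dist x y)))
      E = ∑ xs (λ x → ∑ xs (λ y → [ x ≟ⱽ y ]))
      ∑∑R : ∑ xs (λ x → ∑ xs (R x)) ≡ l * l + κ * E - qℤ * M
      ∑∑R = begin-equality
        ∑ xs (λ x → ∑ xs (λ y → κ * [ x ≟ⱽ y ] - τ (dist x y)))
          ≡⟨ ∑-cong xs (λ x → trans (∑-- xs) (cong₂ _-_ (∑-*ˡ xs κ) (trans (∑-- xs) (cong₂ _-_ (∑-*ˡ xs qℤ) (∑-1 xs))))) ⟩
        ∑ xs (λ x → κ * ∑ xs (λ y → [ x ≟ⱽ y ]) - (qℤ * ∑ xs (λ y → δ (dist x y)) - l))
          ≡⟨ trans (∑-- xs) (cong₂ _-_ (∑-*ˡ xs κ) (trans (∑-- xs) (cong₂ _-_ (∑-*ˡ xs qℤ) (∑-const xs l)))) ⟩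
        κ * E - (qℤ * M - l * l)
          ≡⟨ lemma (κ * E) (qℤ * M) (l * l) ⟩
        l * l + κ * E - qℤ * M
          ∎
        where
        lemma : ∀ e m p → e - (m - p) ≡ p + e - m
        lemma = solve-∀
      instance
        κ≥0 : ℤ.NonNegative κ
        κ≥0 = subst ℤ.NonNegative (pos-^ q h) _
      diagonal : E ≤ l
      diagonal = ℤ.≤-trans (∑-mono xs (λ x → ∑-Unique≤1 _≟ⱽ_ xs! x)) (ℤ.≤-reflexive (∑-1 xs))

-- Transport of the given field to `Fin q`.

module Transport {c ℓ : Level} {q : ℕ} (F : FiniteField c ℓ q) where
  open FiniteField F using (≉0⇒invertible; enumeration; 1≉0)
    renaming (commutativeRing to R)
  open CommutativeRing R hiding (refl; sym; trans)
  open Bijection enumeration using (to; injective; strictlySurjective) renaming (cong to to-cong)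
  private module R = CommutativeRing R

  from : Fin q → Carrier
  from x = proj₁ (strictlySurjective x)

  to-from : ∀ x → to (from x) ≡ x
  to-from x = proj₂ (strictlySurjective x)

  from-to : ∀ x → from (to x) ≈ x
  from-to x = injective (to-from (to x))

  private
    rawRing′ : RawRing _ _
    rawRing′ = record
      { Carrier = Fin q
      ; _≈_     = _≡_
      ; _+_     = λ x y → to (from x + from y)
      ; _*_     = λ x y → to (from x * from y)
      ; -_      = λ x → to (- from x)
      ; 0#      = to 0#
      ; 1#      = to 1#
      }

    -- The ring laws on `Fin q` are pulled back along this injection rather than checked one by one.
    from-isRingMonomorphism : IsRingMonomorphism rawRing′ rawRing from
    from-isRingMonomorphism = record
      { isRingHomomorphism = record
        { isSemiringHomomorphism = record
          { isNearSemiringHomomorphism = record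
            { +-isMonoidHomomorphism = record
              { isMagmaHomomorphism = record
                { isRelHomomorphism = record { cong = λ { refl → R.refl } }
                ; homo = λ x y → from-to _
                }
              ; ε-homo = from-to _
              }
            ; *-homo = λ x y → from-to _
            }
          ; 1#-homo = from-to _
          }
        ; -‿homo = λ x → from-to _
        }
      ; injective = λ {x} {y} eq → trans (sym (to-from x)) (trans (to-cong eq) (to-from y))
      }

  fieldOn : FieldOn (Fin q)
  fieldOn = record
    { _⊕_               = λ x y → to (from x + from y)
    ; _⊗_               = λ x y → to (from x * from y)
    ; ⊖_                = λ x → to (- from x)
    ; 𝟘                 = to 0#
    ; 𝟙                 = to 1#
    ; isCommutativeRing = RingMonomorphism.isCommutativeRing from-isRingMonomorphism R.isCommutativeRing
    ; 𝟙≢𝟘               = λ eq → 1≉0 (injective eq)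
    ; invertible        = inverse
    }
    where
    inverse : ∀ {x} → x ≢ to 0# → ∃[ y ] to (from y * from x) ≡ to 1#
    inverse {x} x≢0 with ≉0⇒invertible (λ eq → x≢0 (trans (sym (to-from x)) (to-cong eq)))
    ... | y , yx≈1 , _ = to y , to-cong (R.trans (R.*-congʳ (from-to y)) yx≈1)

  open FieldOn fieldOn using (_⊕_; _⊗_; ⊖_; _⊝_; 𝟘)

  to-+ : ∀ x y → to (x + y) ≡ to x ⊕ to y
  to-+ x y = to-cong (R.sym (R.+-cong (from-to x) (from-to y)))

  to-* : ∀ x y → to (x * y) ≡ to x ⊗ to y
  to-* x y = to-cong (R.sym (R.*-cong (from-to x) (from-to y)))

  to-neg : ∀ x → to (- x) ≡ ⊖ to x
  to-neg x = to-cong (R.sym (R.-‿cong (from-to x)))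

  to-- : ∀ x y → to (x - y) ≡ to x ⊝ to y
  to-- x y = trans (to-+ x (- y)) (cong (to x ⊕_) (to-neg y))

  open Sum +-commutativeMonoid using (sum)

  coordinates : ∀ {d} → (Fin d → Carrier) → Vec (Fin q) d
  coordinates p = Vec.tabulate (to ∘ p)

  coordinates-injective : ∀ {d} {x y : Fin d → Carrier} → coordinates x ≡ coordinates y → ∀ i → x i ≈ y i
  coordinates-injective {x = x} {y} eq i = injective (begin
    to (x i)                      ≡⟨ Vec.lookup∘tabulate (to ∘ x) i ⟨
    Vec.lookup (coordinates x) i  ≡⟨ cong (λ v → Vec.lookup v i) eq ⟩
    Vec.lookup (coordinates y) i  ≡⟨ Vec.lookup∘tabulate (to ∘ y) i ⟩
    to (y i)                      ∎)
    where open ≡-Reasoning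

  module _ (q%4≡3 : q ℕ.% 4 ≡ 3) where
    open Counting fieldOn q%4≡3
    open Distances fieldOn q%4≡3

    dist-coordinates : ∀ {d} (x a : Fin d → Carrier) →
      dist (coordinates x) (coordinates a) ≡ to (sum (λ i → (x i - a i) * (x i - a i)))
    dist-coordinates {zero}  x a = refl
    dist-coordinates {suc d} x a = sym (trans (to-+ _ _) (cong₂ _⊕_
      (trans (to-* _ _) (cong (λ t → t ⊗ t) (to-- _ _)))
      (sym (dist-coordinates (x ∘ Fin.suc) (a ∘ Fin.suc)))))

    NonSquare⇒¬IsSquare : ∀ {r} → (∀ t → r ≉ t * t) → ¬ IsSquare (to r)
    NonSquare⇒¬IsSquare {r} ¬sq (t , t²≡r) = ¬sq (from t) (R.sym (injective t²≡r))

-- Unnormalised fractions are compared by cross-multiplication, and there the hypothesis, cleared of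
-- the denominator q, is the claim up to ring arithmetic.
/-bound : ∀ q C I M X .{{_ : ℕ.NonZero q}} → q ℕ.* I ℕ.≤ C ℕ.* (M ℕ.+ q ℕ.* X) →
          (ℤ.+ I) ℚ./ 1 ℚ.≤ (ℤ.+ C) ℚ./ 1 ℚ.* ((ℤ.+ M) ℚ./ q ℚ.+ (ℤ.+ X) ℚ./ 1)
/-bound q@(suc q-1) C I M X qI≤ = ℚ.toℚᵘ-cancel-≤ (begin
  ℚ.toℚᵘ ((ℤ.+ I) ℚ./ 1)
    ≃⟨ ℚ.toℚᵘ-fromℚᵘ Iᵘ ⟩
  Iᵘ
    ≤⟨ ℚᵘ.*≤* cleared ⟩
  Cᵘ ℚᵘ.* (Mᵘ ℚᵘ.+ Xᵘ)
    ≃⟨ ℚᵘ.*-cong (ℚ.toℚᵘ-fromℚᵘ Cᵘ) (ℚᵘ.+-cong (ℚ.toℚᵘ-fromℚᵘ Mᵘ) (ℚ.toℚᵘ-fromℚᵘ Xᵘ)) ⟨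
  ℚ.toℚᵘ ((ℤ.+ C) ℚ./ 1) ℚᵘ.* (ℚ.toℚᵘ ((ℤ.+ M) ℚ./ q) ℚᵘ.+ ℚ.toℚᵘ ((ℤ.+ X) ℚ./ 1))
    ≃⟨ ℚᵘ.*-congˡ {ℚ.toℚᵘ ((ℤ.+ C) ℚ./ 1)} (ℚ.toℚᵘ-homo-+ ((ℤ.+ M) ℚ./ q) ((ℤ.+ X) ℚ./ 1)) ⟨
  ℚ.toℚᵘ ((ℤ.+ C) ℚ./ 1) ℚᵘ.* ℚ.toℚᵘ ((ℤ.+ M) ℚ./ q ℚ.+ (ℤ.+ X) ℚ./ 1)
    ≃⟨ ℚ.toℚᵘ-homo-* ((ℤ.+ C) ℚ./ 1) ((ℤ.+ M) ℚ./ q ℚ.+ (ℤ.+ X) ℚ./ 1) ⟨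
  ℚ.toℚᵘ ((ℤ.+ C) ℚ./ 1 ℚ.* ((ℤ.+ M) ℚ./ q ℚ.+ (ℤ.+ X) ℚ./ 1))
    ∎)
  where
  open ℚᵘ.≤-Reasoning
  Iᵘ Cᵘ Mᵘ Xᵘ : ℚᵘ.ℚᵘ
  -- The second argument of `mkℚᵘ` is the denominator minus one.
  Iᵘ = ℚᵘ.mkℚᵘ (ℤ.+ I) 0
  Cᵘ = ℚᵘ.mkℚᵘ (ℤ.+ C) 0
  Mᵘ = ℚᵘ.mkℚᵘ (ℤ.+ M) q-1
  Xᵘ = ℚᵘ.mkℚᵘ (ℤ.+ X) 0
  cleared : ℚᵘ.↥ Iᵘ ℤ.* ℚᵘ.↧ (Cᵘ ℚᵘ.* (Mᵘ ℚᵘ.+ Xᵘ)) ℤ.≤ ℚᵘ.↥ (Cᵘ ℚᵘ.* (Mᵘ ℚᵘ.+ Xᵘ)) ℤ.* ℚᵘ.↧ Iᵘ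
  cleared = subst₂ ℤ._≤_
    (trans (ℤ.pos-* q I) (trans (ℤ.*-comm (ℤ.+ q) (ℤ.+ I)) (cong (λ n → ℤ.+ I ℤ.* ℤ.+ n) (sym denominator))))
    numerator (ℤ.+≤+ qI≤)
    where
    denominator : suc (q-1 ℕ.* 1 ℕ.+ 0) ≡ q
    denominator = cong suc (trans (ℕ.+-identityʳ _) (ℕ.*-identityʳ q-1))
    numerator : ℤ.+ (C ℕ.* (M ℕ.+ q ℕ.* X)) ≡ ℤ.+ C ℤ.* (ℤ.+ M ℤ.* ℤ.+ 1 ℤ.+ ℤ.+ X ℤ.* ℤ.+ q) ℤ.* ℤ.+ 1
    numerator = trans (ℤ.pos-* C _) (trans (cong (λ x → ℤ.+ C ℤ.* (ℤ.+ M ℤ.+ x)) (ℤ.pos-* q X)) (lemma (ℤ.+ C) (ℤ.+ M) (ℤ.+ q) (ℤ.+ X)))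
      where
      lemma : ∀ c m q x → c ℤ.* (m ℤ.+ q ℤ.* x) ≡ c ℤ.* (m ℤ.* ℤ.+ 1 ℤ.+ x ℤ.* q) ℤ.* ℤ.+ 1
      lemma = solve-∀

-- Lifted points and spheres, and the incidence bound.

module Incidences {c ℓ : Level} {q : ℕ} (F : FiniteField c ℓ q) (q%4≡3 : q ℕ.% 4 ≡ 3) (k : ℕ) where
  -- Written so that `suc d` reduces to h · 2 with h = `suc (k ℕ.* 2)`: the lifts then live in the
  -- space of the spectral bound without any coercion.
  d = suc (k ℕ.* 2 ℕ.* 2)

  open import Data.Integer.Base using (_≤_)
  open Transport F
  open FieldOn fieldOn using (_⊕_; _⊗_; ⊖_; _⊝_; 𝟘; commutativeRing)
  open Counting fieldOn q%4≡3
  open Distances fieldOn q%4≡3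
  open IntegerCoefficients commutativeRing
  open Bijection (FiniteField.enumeration F) using (to; injective) renaming (cong to to-cong)
  open Spheres F d
  open FiniteField F using (_≈_)

  root : Fin q → Fin q
  root r with isSquare? (⊖ r)
  ... | yes (t , _) = t
  -- A default value; `root²` excludes this branch when `r` is a nonsquare.
  ... | no _        = 𝟘

  root² : ∀ {r} → ¬ IsSquare r → root r ⊗ root r ≡ ⊖ r
  root² {r} ¬sq with isSquare? (⊖ r)
  ... | yes (t , t²≡-r) = t²≡-r
  ... | no ¬sq′         = ⊥-elim (¬sq′ (nonsquare⇒⊖square ¬sq))

  -- A sphere with nonsquare radius r = − t² and centre a is the set of x for
  -- which (0 , x) and (t , a) are at distance zero.
  liftPoint : Point → V (suc d)
  liftPoint p = 𝟘 ∷ coordinates p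

  liftSphere : Sphere → V (suc d)
  liftSphere (a , r) = root (to r) ∷ coordinates a

  dist-lift : ∀ {p s} → NonSquare (proj₂ s) → p liesOn s → dist (liftPoint p) (liftSphere s) ≡ 𝟘
  dist-lift {p} {a , r} (_ , ¬sq) on = begin
    sq (𝟘 ⊝ t) ⊕ dist (coordinates p) (coordinates a)
      ≡⟨ cong (sq (𝟘 ⊝ t) ⊕_) (trans (dist-coordinates q%4≡3 p a) (to-cong on)) ⟩
    sq (𝟘 ⊝ t) ⊕ to r
      ≡⟨ solve 2 (λ t r → (con 0ℤ :- t) :* (con 0ℤ :- t) :+ r := t :* t :+ r) refl t (to r) ⟩
    t ⊗ t ⊕ to r                                         ≡⟨ cong (_⊕ to r) (root² (NonSquare⇒¬IsSquare q%4≡3 ¬sq)) ⟩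
    ⊖ to r ⊕ to r                                        ≡⟨ solve 1 (λ r → (:- r) :+ r := con 0ℤ) refl (to r) ⟩
    𝟘                                                    ∎
    where
    open ≡-Reasoning
    t = root (to r)

  liftPoint-injective : ∀ {p p′} → liftPoint p ≡ liftPoint p′ → ∀ i → p i ≈ p′ i
  liftPoint-injective eq = coordinates-injective (Vec.∷-injectiveʳ eq)

  -- The extra coordinate t determines the radius as -t², so concentric spheres of different radii
  -- have different lifts.
  liftSphere-injective : ∀ {a r a′ r′} → NonSquare r → NonSquare r′ →
    liftSphere (a , r) ≡ liftSphere (a′ , r′) → (∀ i → a i ≈ a′ i) × r ≈ r′
  liftSphere-injective {r = r} {r′ = r′} (_ , ¬sq) (_ , ¬sq′) eq = coordinates-injective (Vec.∷-injectiveʳ eq) , injective (begin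
    to r              ≡⟨ solve 1 (λ r → r := :- (:- r)) refl (to r) ⟩
    ⊖ ⊖ to r          ≡⟨ cong ⊖_ (root² (NonSquare⇒¬IsSquare q%4≡3 ¬sq)) ⟨
    ⊖ sq (root (to r))   ≡⟨ cong (λ t → ⊖ sq t) (Vec.∷-injectiveˡ eq) ⟩
    ⊖ sq (root (to r′))  ≡⟨ cong ⊖_ (root² (NonSquare⇒¬IsSquare q%4≡3 ¬sq′)) ⟩
    ⊖ ⊖ to r′         ≡⟨ solve 1 (λ r → r := :- (:- r)) refl (to r′) ⟨
    to r′             ∎)
    where open ≡-Reasoning

  -- Equal lifts would force t = 0, and then the radius -t² = 0 would be the square of zero.
  liftPoint≢liftSphere : ∀ {p s} → NonSquare (proj₂ s) → liftPoint p ≢ liftSphere s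
  liftPoint≢liftSphere {p} {a , r} (_ , ¬sq) eq = NonSquare⇒¬IsSquare q%4≡3 ¬sq (𝟘 , (begin
    𝟘 ⊗ 𝟘           ≡⟨ solve 0 (con 0ℤ :* con 0ℤ := :- (con 0ℤ :* con 0ℤ)) refl ⟩
    ⊖ (𝟘 ⊗ 𝟘)       ≡⟨ cong (λ t → ⊖ sq t) (Vec.∷-injectiveˡ eq) ⟩
    ⊖ sq (root (to r))  ≡⟨ cong ⊖_ (root² (NonSquare⇒¬IsSquare q%4≡3 ¬sq)) ⟩
    ⊖ ⊖ to r        ≡⟨ solve 1 (λ r → r := :- (:- r)) refl (to r) ⟨
    to r            ∎))
    where open ≡-Reasoning

  module _ {P S} (P! : Unique points P) (S! : Unique spheres S) (S-nonsquare : All (NonSquare ∘ proj₂) S) where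
    lifted : List (V (suc d))
    lifted = map liftPoint P ++ map liftSphere S

    lifted-unique : Propositional.Unique lifted
    lifted-unique = AllPairs.++⁺
      (AllPairs.map⁺ (AllPairs.map (λ p≉p′ eq → p≉p′ (liftPoint-injective eq)) P!))
      (AllPairs.map⁺ (spheres-unique S-nonsquare S!))
      (All.map⁺ (All.universal (λ p → All.map⁺ (All.map (λ {s} ns → liftPoint≢liftSphere {p} {s} ns) S-nonsquare)) P))
      where
      spheres-unique : ∀ {S} → All (NonSquare ∘ proj₂) S → Unique spheres S →
                       AllPairs (λ s s′ → liftSphere s ≢ liftSphere s′) S
      spheres-unique [] [] = []
      spheres-unique (ns ∷ nss) (s∉S ∷ S!) =
        All.zipWith (λ (ns′ , s≉s′) eq → s≉s′ (liftSphere-injective ns ns′ eq)) (nss , s∉S) ∷ spheres-unique nss S!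

    -- The incidences lie in one off-diagonal block of the zero-distance matrix of the joint list;
    -- the other blocks have nonnegative entries.
    incidences≤ : ℤ.+ incidences P S ≤ ∑ lifted (λ x → ∑ lifted (λ y → δ (dist x y)))
    incidences≤ = begin
      ℤ.+ incidences P S
        ≡⟨ ∑-filter (uncurry _liesOn?_) (cartesianProduct P S) ⟩
      ∑ (cartesianProduct P S) (λ ps → [ uncurry _liesOn?_ ps ])
        ≡⟨ ∑-cartesianProduct P S ⟩
      ∑ P (λ p → ∑ S (λ s → [ p liesOn? s ]))
        ≤⟨ ∑-mono P (λ p → ∑-mono-All (λ {s} ns → []-mono (p liesOn? s) (_ Fin.≟ 𝟘) (dist-lift {p} {s} ns)) S-nonsquare) ⟩
      ∑ P (λ p → ∑ S (λ s → δ (dist (liftPoint p) (liftSphere s))))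
        ≡⟨ trans (∑-map liftPoint P) (∑-cong P (λ p → ∑-map liftSphere S)) ⟨
      ∑ P′ (λ x → ∑ S′ (λ y → δ (dist x y)))
        ≤⟨ ∑-mono P′ (λ x → ∑-mono-++ʳ P′ S′ (λ y → 0≤[ dist x y Fin.≟ 𝟘 ])) ⟩
      ∑ P′ (λ x → ∑ lifted (λ y → δ (dist x y)))
        ≤⟨ ∑-mono-++ˡ P′ S′ (λ x → 0≤∑ lifted (λ y → 0≤[ dist x y Fin.≟ 𝟘 ])) ⟩
      ∑ lifted (λ x → ∑ lifted (λ y → δ (dist x y)))
        ∎
      where
      open ℤ.≤-Reasoning
      P′ = map liftPoint P
      S′ = map liftSphere S

    q*incidences≤ : let l = length P ℕ.+ length S in
      q ℕ.* incidences P S ℕ.≤ l ℕ.* l ℕ.+ q ℕ.^ suc (k ℕ.* 2) ℕ.* l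
    q*incidences≤ = ℤ.drop‿+≤+ (begin
      ℤ.+ (q ℕ.* incidences P S)                   ≡⟨ ℤ.pos-* q (incidences P S) ⟩
      qℤ ℤ.* ℤ.+ incidences P S                    ≤⟨ ℤ.*-monoˡ-≤-nonNeg qℤ incidences≤ ⟩
      qℤ ℤ.* ∑ lifted (λ x → ∑ lifted (λ y → δ (dist x y)))
                                                   ≤⟨ ∑-δ-dist≤ k lifted-unique ⟩
      L ℤ.* L ℤ.+ qℤ ℤ.^ suc (k ℕ.* 2) ℤ.* L
        ≡⟨ cong₂ ℤ._+_ (ℤ.pos-* (length lifted) (length lifted)) (trans (ℤ.pos-* (q ℕ.^ suc (k ℕ.* 2)) (length lifted)) (cong (ℤ._* L) (pos-^ q (suc (k ℕ.* 2))))) ⟨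
      ℤ.+ (length lifted ℕ.* length lifted ℕ.+ q ℕ.^ suc (k ℕ.* 2) ℕ.* length lifted)
                                                   ≡⟨ cong (λ l → ℤ.+ (l ℕ.* l ℕ.+ q ℕ.^ suc (k ℕ.* 2) ℕ.* l)) length-lifted ⟩
      ℤ.+ (l ℕ.* l ℕ.+ q ℕ.^ suc (k ℕ.* 2) ℕ.* l)  ∎)
      where
      open ℤ.≤-Reasoning
      l = length P ℕ.+ length S
      L = ℤ.+ length lifted
      length-lifted : length lifted ≡ l
      length-lifted = trans (List.length-++ (map liftPoint P)) (cong₂ ℕ._+_ (List.length-map liftPoint P) (List.length-map liftSphere S))

    -- As h = 2k + 1, one factor q of qʰ matches the q on the left, and the remaining exponent 2k is
    -- (d - 1)/2.
    q*incidences≤4* : ∀ {N} → length P ℕ.≤ N → length S ℕ.≤ N →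
      q ℕ.* incidences P S ℕ.≤ 4 ℕ.* (N ℕ.^ 2 ℕ.+ q ℕ.* (q ℕ.^ ((d ℕ.∸ 1) ℕ./ 2) ℕ.* N))
    q*incidences≤4* {N} P≤N S≤N = begin
      q ℕ.* incidences P S                                     ≤⟨ q*incidences≤ ⟩
      l ℕ.* l ℕ.+ q ℕ.* X ℕ.* l                                ≤⟨ ℕ.+-mono-≤ (ℕ.*-mono-≤ l≤2N l≤2N) (ℕ.*-monoʳ-≤ (q ℕ.* X) l≤2N) ⟩
      -- The added slack raises the coefficient of the second term from 2 to 4, the coefficient that
      -- (2N)² gives to the first.
      (N ℕ.+ N) ℕ.* (N ℕ.+ N) ℕ.+ q ℕ.* X ℕ.* (N ℕ.+ N)        ≤⟨ ℕ.m≤m+n _ (2 ℕ.* (q ℕ.* X ℕ.* N)) ⟩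
      (N ℕ.+ N) ℕ.* (N ℕ.+ N) ℕ.+ q ℕ.* X ℕ.* (N ℕ.+ N) ℕ.+ 2 ℕ.* (q ℕ.* X ℕ.* N)
                                                               ≡⟨ lemma N q X ⟩
      4 ℕ.* (N ℕ.^ 2 ℕ.+ q ℕ.* (X ℕ.* N))
        ≡⟨ cong (λ e → 4 ℕ.* (N ℕ.^ 2 ℕ.+ q ℕ.* (q ℕ.^ e ℕ.* N))) (ℕ.m*n/n≡m (k ℕ.* 2) 2) ⟨
      4 ℕ.* (N ℕ.^ 2 ℕ.+ q ℕ.* (q ℕ.^ ((d ℕ.∸ 1) ℕ./ 2) ℕ.* N))    ∎
      where
      open ℕ.≤-Reasoning
      l = length P ℕ.+ length S
      X = q ℕ.^ (k ℕ.* 2)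
      l≤2N = ℕ.+-mono-≤ P≤N S≤N
      lemma : ∀ N q X → (N ℕ.+ N) ℕ.* (N ℕ.+ N) ℕ.+ q ℕ.* X ℕ.* (N ℕ.+ N) ℕ.+ 2 ℕ.* (q ℕ.* X ℕ.* N) ≡
                        4 ℕ.* (N ℕ.* (N ℕ.* 1) ℕ.+ q ℕ.* (X ℕ.* N))
      lemma = ℕ.solve-∀

d≡1+4k : ∀ d → d ℕ.% 4 ≡ 1 → ∃[ k ] d ≡ suc (k ℕ.* 2 ℕ.* 2)
d≡1+4k d d%4≡1 = d ℕ./ 4 , trans (ℕ.m≡m%n+[m/n]*n d 4)
  (cong₂ ℕ._+_ d%4≡1 (sym (ℕ.*-assoc (d ℕ./ 4) 2 2)))

open import Data.Integer.Base using (+_)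
open import Data.Rational.Base using (ℚ; 0ℚ; _/_; _+_; _*_; _≤_; _<_)

theorem1p7 : ∀ {c ℓ : Level} →
  ∃[ C ] (0ℚ < C ×
    ((q d : ℕ) .{{_ : NonZero q}} →
     IsOddPrimePower q → q % 4 ≡ 3 → d % 4 ≡ 1 →
     (F : FiniteField c ℓ q) → let open Spheres F d in
     (P : List Point) → Unique points P →
     (S : List Sphere) → Unique spheres S →
     All (λ s → NonSquare (proj₂ s)) S →
     (N : ℕ) → length P ℕ.≤ N → length S ℕ.≤ N →
     (+ incidences P S) / 1
       ≤ C * ((+ (N ^ 2)) / q + (+ (q ^ ((d ∸ 1) ℕ./ 2) ℕ.* N)) / 1)))
theorem1p7 = (+ 4) / 1 , ℚ.positive⁻¹ ((+ 4) / 1) , λ q d _ q%4≡3 d%4≡1 F →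
  case d≡1+4k d d%4≡1 of λ { (k , refl) P P! S S! S-nonsquare N P≤N S≤N → let open Spheres F d in
    /-bound q 4 (incidences P S) (N ^ 2) (q ^ ((d ∸ 1) ℕ./ 2) ℕ.* N)
      (Incidences.q*incidences≤4* F q%4≡3 k P! S! S-nonsquare P≤N S≤N) }
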